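{- For any prime $p>263$ and any Tarski monster $\mathcal{T}_p$ of exponent $p$, there exists a generating set $T$ of $\mathcal{T}_p$ of size $12$ such that if $\psi\colon \mathrm{Cay}(\mathcal{T}_p,T)\to\Delta$ is a covering whose restrictions to balls of radius $1$ are isomorphisms, then either $\psi$ is the identity (i.e. $\psi$ is a graph isomorphism), or $\Delta$ is infinite and the action of $\mathrm{Aut}(\Delta)$ on the vertices of $\Delta$ has finite orbits. In particular, if the covering is not trivial (not an isomorphism), then $\Delta$ is not vertex-transitive, and not even quasi-transitive.
   Context: For a prime $p$, a Tarski monster of exponent $p$ is an infinite group such that every non-trivial proper subgroup is cyclic of order $p$. Graphs are simple and undirected. For a generating set $T$ of $G$ with $1_G\notin T$, $\mathrm{Cay}(G,T)$ has vertex set $G$ and edge set $\{(g,h)\mid g^{ -1}h\in T\cup T^{ -1}\}$. The ball of radius $1$ around a vertex $v$ is the induced subgraph on $v$ and its neighbours. A covering $\varphi\colon\Gamma\to\Delta$ of graphs is a surjective map between vertex sets such that for every vertex $v$ the restriction of $\varphi$ to the set of neighbours of $v$ is a bijection onto the set of neighbours of $\varphi(v)$; its restrictions to balls of radius $1$ are isomorphisms if, for every $v$, it restricts to a graph isomorphism from the ball of radius $1$ around $v$ onto the ball of radius $1$ around $\varphi(v)$. A graph is quasi-transitive if its automorphism group has finitely many orbits of vertices. -}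

module Defs where

open import Algebra.Bundles using (Group)
import Algebra.Properties.Group as GroupProperties
open import Data.Fin.Base using (Fin)
open import Data.Nat.Base using (ℕ)
open import Data.Product.Base as Product using (Σ; ∃; _×_; _,_; proj₁; proj₂)
open import Data.Sum.Base as Sum using (_⊎_; inj₁; inj₂)
open import Function.Base using (id; _∘_)
open import Function.Bundles using (Bijection)
open import Function.Definitions using (Congruent; Bijective; Surjective)
open import Level using (Level; _⊔_) renaming (suc to lsuc)
open import Relation.Binary.Bundles using (Setoid)
open import Relation.Binary.Core using (Rel)
open import Relation.Binary.Definitions
  using (Symmetric; Irreflexive; _Respects_; _Respects₂_)
import Relation.Binary.Construct.On as On
import Relation.Binary.Morphism.Construct.Composition as Composition
import Relation.Binary.Morphism.Construct.Identity as Identity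
open import Relation.Binary.Morphism.Structures using (IsOrderIsomorphism)
open import Relation.Binary.PropositionalEquality using (setoid)
import Relation.Binary.Reasoning.Setoid as SetoidReasoning
open import Relation.Nullary.Negation.Core using (¬_; contradiction)
open import Relation.Unary using (Pred; _∈_; _∉_; _∪_; _⊢_; _≐_; Universal)

private
  variable
    a b c h ℓ e v₁ ℓ₁ e₁ v₂ ℓ₂ e₂ : Level

-- Sets are setoids throughout, since quotients (such as the vertex sets of
-- quotient graphs) are only available in that form.

infix 5 _↾_

_↾_ : (S : Setoid a ℓ) → Pred (Setoid.Carrier S) b → Setoid (a ⊔ b) ℓ
S ↾ P = On.setoid S (proj₁ {B = P})

HasSize : ℕ → Setoid a ℓ → Set (a ⊔ ℓ)
HasSize n S = Bijection (setoid (Fin n)) S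

Finite : Setoid a ℓ → Set (a ⊔ ℓ)
Finite S = ∃ λ n → HasSize n S

Infinite : Setoid a ℓ → Set (a ⊔ ℓ)
Infinite S = ¬ Finite S

module _ (G : Group c ℓ) where
  open Group G
    renaming (setoid to elements)

  record IsSubgroup (H : Pred Carrier h) : Set (c ⊔ ℓ ⊔ h) where
    field
      respects  : H Respects _≈_
      ε-closed  : ε ∈ H
      ∙-closed  : ∀ {x y} → x ∈ H → y ∈ H → (x ∙ y) ∈ H
      ⁻¹-closed : ∀ {x} → x ∈ H → (x ⁻¹) ∈ H

  data ⟨_⟩ (S : Pred Carrier h) : Pred Carrier (c ⊔ ℓ ⊔ h) where
    gen  : ∀ {x} → x ∈ S → x ∈ ⟨ S ⟩
    unit : ε ∈ ⟨ S ⟩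
    mul  : ∀ {x y} → x ∈ ⟨ S ⟩ → y ∈ ⟨ S ⟩ → (x ∙ y) ∈ ⟨ S ⟩
    inv  : ∀ {x} → x ∈ ⟨ S ⟩ → (x ⁻¹) ∈ ⟨ S ⟩
    resp : ∀ {x y} → x ≈ y → x ∈ ⟨ S ⟩ → y ∈ ⟨ S ⟩

  NonTrivial : Pred Carrier h → Set (c ⊔ ℓ ⊔ h)
  NonTrivial H = ∃ λ x → x ∈ H × ¬ (x ≈ ε)

  Proper : Pred Carrier h → Set (c ⊔ h)
  Proper H = ∃ λ x → x ∉ H

  IsCyclic : Pred Carrier h → Set (c ⊔ ℓ ⊔ h)
  IsCyclic H = ∃ λ g → H ≐ ⟨ g ≈_ ⟩

  -- The level c ⊔ ℓ is the lowest at which the subgroups ⟨ S ⟩ live; using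
  -- only this one makes for a weaker requirement than using all levels.
  record IsTarskiMonster (p : ℕ) : Set (lsuc (c ⊔ ℓ)) where
    field
      infinite  : Infinite elements
      subgroups : (H : Pred Carrier (c ⊔ ℓ)) → IsSubgroup H →
                  NonTrivial H → Proper H →
                  IsCyclic H × HasSize p (elements ↾ H)

  record GeneratingSet : Set (c ⊔ lsuc ℓ) where
    field
      member    : Pred Carrier ℓ
      respects  : member Respects _≈_
      ε∉        : ε ∉ member
      generates : Universal ⟨ member ⟩

  members : GeneratingSet → Setoid (c ⊔ ℓ) ℓ
  members T = elements ↾ GeneratingSet.member T

record Graph (a ℓ e : Level) : Set (lsuc (a ⊔ ℓ ⊔ e)) where
  infix 4 _~_
  field
    vertices : Setoid a ℓ
  open Setoid vertices public using (_≈_) renaming (Carrier to Vertex)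
  field
    _~_        : Rel Vertex e
    ~-resp-≈   : _~_ Respects₂ _≈_
    ~-sym      : Symmetric _~_
    ~-irrefl   : Irreflexive _≈_ _~_

  Neighbours : Vertex → Pred Vertex e
  Neighbours v = v ~_

  Ball₁ : Vertex → Pred Vertex (ℓ ⊔ e)
  Ball₁ v = (v ≈_) ∪ Neighbours v

open Graph using (Vertex; vertices; Neighbours; Ball₁)

Induced : (Γ : Graph a ℓ e) → Pred (Vertex Γ) b → Graph (a ⊔ b) ℓ e
Induced Γ P = record
  { vertices = vertices Γ ↾ P
  ; _~_      = λ x y → proj₁ x ~ proj₁ y
  ; ~-resp-≈ = proj₁ ~-resp-≈ , proj₂ ~-resp-≈
  ; ~-sym    = ~-sym
  ; ~-irrefl = ~-irrefl
  } where open Graph Γ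

Cay : (G : Group c ℓ) → GeneratingSet G → Graph c ℓ ℓ
Cay G T = record
  { vertices = elements
  ; _~_      = λ g h → (g ⁻¹ ∙ h) ∈ T±
  ; ~-resp-≈ = (λ h≈h′ → T±-resp (∙-congˡ h≈h′))
             , (λ g≈g′ → T±-resp (∙-congʳ (⁻¹-cong g≈g′)))
  ; ~-sym    = λ {g} {h} → λ
      { (inj₁ t) → inj₂ (respects (≈-sym (flip h g)) t)
      ; (inj₂ t) → inj₁ (respects (flip g h) t)
      }
  ; ~-irrefl = λ {g} {h} g≈h → λ
      { (inj₁ t) → ε∉ (respects (diag g≈h) t)
      ; (inj₂ t) → ε∉ (respects (≈-trans (⁻¹-cong (diag g≈h)) ε⁻¹≈ε) t)
      }
  }
  where
  open Group G renaming (setoid to elements; sym to ≈-sym; trans to ≈-trans)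
  open GroupProperties G using (⁻¹-anti-homo-∙; ⁻¹-involutive; ε⁻¹≈ε)
  open GeneratingSet T

  T± : Pred Carrier _
  T± = member ∪ (_⁻¹ ⊢ member)

  T±-resp : T± Respects _≈_
  T±-resp x≈y = Sum.map (respects x≈y) (respects (⁻¹-cong x≈y))

  flip : ∀ g h → (g ⁻¹ ∙ h) ⁻¹ ≈ h ⁻¹ ∙ g
  flip g h = ≈-trans (⁻¹-anti-homo-∙ (g ⁻¹) h) (∙-congˡ (⁻¹-involutive g))

  diag : ∀ {g h} → g ≈ h → g ⁻¹ ∙ h ≈ ε
  diag g≈h = ≈-trans (∙-congˡ (≈-sym g≈h)) (inverseˡ _)

module _ (Γ : Graph v₁ ℓ₁ e₁) (Δ : Graph v₂ ℓ₂ e₂) where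
  private
    module Γ = Graph Γ
    module Δ = Graph Δ

  -- The library's order isomorphisms impose nothing on the two relations:
  -- they are the setoid bijections that preserve and reflect adjacency.
  IsGraphIsomorphism : (Vertex Γ → Vertex Δ) → Set (v₁ ⊔ ℓ₁ ⊔ e₁ ⊔ v₂ ⊔ ℓ₂ ⊔ e₂)
  IsGraphIsomorphism = IsOrderIsomorphism Γ._≈_ Δ._≈_ Γ._~_ Δ._~_

module _ (Γ : Graph v₁ ℓ₁ e₁) (Δ : Graph v₂ ℓ₂ e₂) where
  private
    module Γ = Graph Γ
    module Δ = Graph Δ

  record IsCovering (φ : Vertex Γ → Vertex Δ) : Set (v₁ ⊔ ℓ₁ ⊔ e₁ ⊔ v₂ ⊔ ℓ₂ ⊔ e₂) where
    field
      cong       : Congruent Γ._≈_ Δ._≈_ φ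
      surjective : Surjective Γ._≈_ Δ._≈_ φ
      neighbours : ∀ v →
        Σ (∀ {w} → w ∈ Γ.Neighbours v → φ w ∈ Δ.Neighbours (φ v)) λ φ-maps →
          Bijective (Setoid._≈_ (Γ.vertices ↾ Γ.Neighbours v))
                    (Setoid._≈_ (Δ.vertices ↾ Δ.Neighbours (φ v)))
                    (Product.map φ φ-maps)

  IsIsomorphismOnBalls₁ : (Vertex Γ → Vertex Δ) → Set (v₁ ⊔ ℓ₁ ⊔ e₁ ⊔ v₂ ⊔ ℓ₂ ⊔ e₂)
  IsIsomorphismOnBalls₁ φ = ∀ v →
    Σ (∀ {w} → w ∈ Γ.Ball₁ v → φ w ∈ Δ.Ball₁ (φ v)) λ φ-maps →
      IsGraphIsomorphism (Induced Γ (Γ.Ball₁ v)) (Induced Δ (Δ.Ball₁ (φ v)))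
                         (Product.map φ φ-maps)

module _ (Γ : Graph v₁ ℓ₁ e₁) where
  open Graph Γ using (_≈_; _~_; ~-resp-≈)
  open Setoid (vertices Γ) using (refl; sym; trans)

  Aut : Set (v₁ ⊔ ℓ₁ ⊔ e₁)
  Aut = ∃ (IsGraphIsomorphism Γ Γ)

  idAut : Aut
  idAut = id , Identity.isOrderIsomorphism _≈_ _~_ refl

  compAut : Aut → Aut → Aut
  compAut (f , f-iso) (g , g-iso) =
    f ∘ g , Composition.isOrderIsomorphism trans g-iso f-iso

  invAut : Aut → Aut
  invAut (f , f-iso) = f⁻¹ , record
    { isOrderMonomorphism = record
      { isOrderHomomorphism = record
        { cong = λ {x} {y} x≈y →
            injective (trans (f∘f⁻¹ x) (trans x≈y (sym (f∘f⁻¹ y))))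
        ; mono = λ {x} {y} x~y →
            cancel (~-resp (sym (f∘f⁻¹ x)) (sym (f∘f⁻¹ y)) x~y)
        }
      ; injective = λ {x} {y} p →
          trans (sym (f∘f⁻¹ x)) (trans (cong p) (f∘f⁻¹ y))
      ; cancel = λ {x} {y} p → ~-resp (f∘f⁻¹ x) (f∘f⁻¹ y) (mono p)
      }
    ; surjective = λ y → f y , λ {z} z≈fy → injective (trans (f∘f⁻¹ z) z≈fy)
    }
    where
    open IsOrderIsomorphism f-iso

    f⁻¹ : Vertex Γ → Vertex Γ
    f⁻¹ = proj₁ ∘ surjective

    f∘f⁻¹ : ∀ x → f (f⁻¹ x) ≈ x
    f∘f⁻¹ x = proj₂ (surjective x) refl

    ~-resp : ∀ {x x′ y y′} → x ≈ x′ → y ≈ y′ → x ~ y → x′ ~ y′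
    ~-resp x≈x′ y≈y′ = proj₂ ~-resp-≈ x≈x′ ∘ proj₁ ~-resp-≈ y≈y′

  SameOrbit : Rel (Vertex Γ) (v₁ ⊔ ℓ₁ ⊔ e₁)
  SameOrbit u w = Σ Aut λ α → proj₁ α u ≈ w

  Orbit : Vertex Γ → Pred (Vertex Γ) (v₁ ⊔ ℓ₁ ⊔ e₁)
  Orbit = SameOrbit

  Orbits : Setoid v₁ (v₁ ⊔ ℓ₁ ⊔ e₁)
  Orbits = record
    { Carrier       = Vertex Γ
    ; _≈_           = SameOrbit
    ; isEquivalence = record
      { refl  = idAut , refl
      ; sym   = λ { {u} (α , αu≈w) →
          let α⁻¹ = invAut α in
          α⁻¹ , IsOrderIsomorphism.injective (proj₂ α)
                  (trans (proj₂ (IsOrderIsomorphism.surjective (proj₂ α) _) refl)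
                         (sym αu≈w)) }
      ; trans = λ { (α , αu≈w) (β , βw≈x) →
          compAut β α , trans (IsOrderIsomorphism.cong (proj₂ β) αu≈w) βw≈x }
      }
    }

  HasFiniteOrbits : Set (v₁ ⊔ ℓ₁ ⊔ e₁)
  HasFiniteOrbits = ∀ v → Finite (vertices Γ ↾ Orbit v)

  IsVertexTransitive : Set (v₁ ⊔ ℓ₁ ⊔ e₁)
  IsVertexTransitive = ∀ u w → SameOrbit u w

  IsQuasiTransitive : Set (v₁ ⊔ ℓ₁ ⊔ e₁)
  IsQuasiTransitive = Finite Orbits

{-# OPTIONS --safe #-}

-- In a Tarski monster every x ≠ 1 generates a self-normalising subgroup of order p, which is
-- the only proper subgroup containing x. Take T = {a^±1, a^±2, a^±3, b^±1, b^±2, c^±1} with c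
-- = a³b² and b ∉ ⟨a⟩ chosen so that a³b²aᵏ ∉ ⟨b⟩ whenever |k| ≤ 3; the pigeonhole principle
-- provides such a b. Up to rotation and inversion a³b²c⁻¹ = 1 is then the only relation of
-- length three between elements of T that does not hold inside one of ⟨a⟩, ⟨b⟩, ⟨c⟩, so the
-- graph induced by Cay(G,T) on the neighbours of a vertex is known explicitly. It has no
-- nontrivial automorphism: its vertices start different numbers of walks of length 3. Hence,
-- if α ψ(g) = ψ(h) for an automorphism α of Δ, then α ψ(gk) = ψ(hk) for all k. With α = id
-- this makes H = {x | ψ(x) = ψ(1)} a subgroup whose right cosets are the fibres of ψ. If H is
-- trivial, ψ is an isomorphism. Otherwise H has order p, so that Δ is infinite, and H is
-- self-normalising, so that Aut(Δ) is trivial.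

module Submission where

open import Defs
open import Algebra.Bundles using (Group)
import Algebra.Properties.CommutativeMonoid.Sum as Sum
import Algebra.Properties.Group as GroupProperties
import Algebra.Properties.Monoid.Mult as Mult
open import Axiom.ExcludedMiddle using (ExcludedMiddle)
open import Data.Bool.Base using (Bool; true; false; not; if_then_else_)
open import Data.Empty using (⊥)
open import Data.Fin.Base using (Fin; zero; suc; toℕ; fromℕ<; punchIn; punchOut; remQuot; combine)
open import Data.Fin.Patterns using (0F; 1F; 2F; 3F; 4F; 5F; 6F)
open import Data.Fin.Permutation using (Permutation′; _⟨$⟩ʳ_)
import Data.Fin.Properties as Fin
open import Data.Integer.Base as ℤ using (ℤ; +_; -[1+_]; 0ℤ; 1ℤ; -1ℤ; ∣_∣; _⊖_)
open import Data.Integer.DivMod using (_%ℕ_; _/ℕ_; n%ℕd<d; a≡a%ℕn+[a/ℕn]*n)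
import Data.Integer.Properties as ℤ
open import Data.List.Base using (List; []; _∷_)
open import Data.List.Membership.DecPropositional using () renaming (_∈?_ to ∈-dec)
open import Data.List.Membership.Propositional using () renaming (_∈_ to _∈ˡ_)
open import Data.List.Relation.Unary.Any using (here; there)
open import Data.Nat.Base as ℕ using (ℕ; zero; suc; _≤_; _<_; _>_; z≤n; s≤s)
open import Data.Nat.Primality using (Prime)
import Data.Nat.Properties as ℕ
open import Data.Product.Base using (Σ; ∃; ∃₂; _×_; _,_; proj₁; proj₂)
open import Data.Product.Properties using () renaming (≡-dec to ×-≡-dec)
open import Data.Sum.Base using (_⊎_; inj₁; inj₂)
open import Data.Vec.Base using (Vec; []; _∷_; lookup)
open import Function.Base using (_∘_; case_of_)
open import Function.Bundles using (Bijection; _⇔_; mk⇔; Equivalence; mk↔ₛ′)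
open import Function.Definitions using (Injective)
open import Level using (_⊔_; Lift; lift; lower)
open import Relation.Binary.Bundles using (Setoid)
open import Relation.Binary.Definitions using (DecidableEquality)
open import Relation.Binary.Morphism.Structures using (IsOrderIsomorphism)
open import Relation.Binary.PropositionalEquality as ≡ using (_≡_; _≢_)
import Relation.Binary.Reasoning.Setoid as SetoidReasoning
import Relation.Binary.Reflection as Reflection
open import Relation.Nullary.Decidable
  using (Dec; yes; no; does; True; toWitness; fromWitness; from-yes; map′; does-⇔; decidable-stable;
         _×-dec_; _⊎-dec_; _→-dec_; ¬?)
open import Relation.Nullary.Negation.Core using (¬_; contradiction)
open import Relation.Unary using (Pred; _∈_; _∉_; _⊆_)

-- Finite setoids

module FiniteSetoid {a ℓ} (S : Setoid a ℓ) where
  open Setoid S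

  Covers : ∀ {n} → (Fin n → Carrier) → Set (a ⊔ ℓ)
  Covers f = ∀ x → ∃ λ i → f i ≈ x

  covers∧injective⇒hasSize : ∀ {n} {f : Fin n → Carrier} →
    Covers f → Injective _≡_ _≈_ f → HasSize n S
  covers∧injective⇒hasSize {f = f} cov inj = record
    { to        = f
    ; cong      = λ { ≡.refl → refl }
    ; bijective = inj , λ x → proj₁ (cov x) , λ { ≡.refl → proj₂ (cov x) }
    }

  -- Induction on `n`: while two indices `i` and `j` list the same element, `i` is dropped by
  -- `punchIn`; a listing without repetitions is a bijection. Excluded middle decides whether there
  -- is a repetition.
  covers⇒finite : (∀ {a} → ExcludedMiddle a) → ∀ n (f : Fin n → Carrier) → Covers f → Finite S
  covers⇒finite em n f cov with em {P = ∃₂ λ i j → i ≢ j × f i ≈ f j}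
  covers⇒finite em n f cov | no ¬p = n , covers∧injective⇒hasSize cov
    λ {i} {j} fi≈fj → decidable-stable (i Fin.≟ j) λ i≢j → ¬p (i , j , i≢j , fi≈fj)
  covers⇒finite em zero f cov | yes (() , _)
  covers⇒finite em (suc n) f cov | yes (i , j , i≢j , fi≈fj) =
    covers⇒finite em n (f ∘ punchIn i) cov′
    where
    at : ∀ {k} (i≢k : i ≢ k) → f (punchIn i (punchOut i≢k)) ≈ f k
    at i≢k = reflexive (≡.cong f (Fin.punchIn-punchOut i≢k))

    cov′ : Covers (f ∘ punchIn i)
    cov′ x with cov x
    ... | k , fk≈x with i Fin.≟ k
    ... | yes ≡.refl = punchOut i≢j , trans (at i≢j) (trans (sym fi≈fj) fk≈x)
    ... | no i≢k     = punchOut i≢k , trans (at i≢k) fk≈x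

  module _ {n} (size : HasSize n S) where
    enumerate : Fin n → Carrier
    enumerate = Bijection.to size

    enumerate-covers : Covers enumerate
    enumerate-covers x = proj₁ (Bijection.surjective size x) , proj₂ (Bijection.surjective size x) ≡.refl

    injection⇒≤ : ∀ {m} {f : Fin m → Carrier} → Injective _≡_ _≈_ f → m ≤ n
    injection⇒≤ {f = f} inj = Fin.injective⇒≤ {f = index} λ {i} {j} eq →
      inj (trans (sym (proj₂ (enumerate-covers (f i))))
        (trans (reflexive (≡.cong enumerate eq)) (proj₂ (enumerate-covers (f j)))))
      where
      index : Fin _ → Fin n
      index = proj₁ ∘ enumerate-covers ∘ f

    covers⇒≥ : ∀ {m} {f : Fin m → Carrier} → Covers f → n ≤ m
    covers⇒≥ {f = f} cov = Fin.injective⇒≤ {f = index} λ {i} {j} eq →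
      Bijection.injective size (trans (sym (proj₂ (cov (enumerate i))))
        (trans (reflexive (≡.cong f eq)) (proj₂ (cov (enumerate j)))))
      where
      index : Fin n → Fin _
      index = proj₁ ∘ cov ∘ enumerate

-- Words and powers in groups

module GroupSolver {c ℓ} (G : Group c ℓ) where
  open Group G
  open GroupProperties G
  open SetoidReasoning setoid

  infixl 7 _⊕_
  infix 8 ⊝_

  data Expr (n : ℕ) : Set where
    var : Fin n → Expr n
    𝟙   : Expr n
    _⊕_ : Expr n → Expr n → Expr n
    ⊝_  : Expr n → Expr n

  ⟦_⟧ : ∀ {n} → Expr n → Vec Carrier n → Carrier
  ⟦ var i ⟧ ρ = lookup ρ i
  ⟦ 𝟙 ⟧     ρ = ε
  ⟦ e ⊕ f ⟧ ρ = ⟦ e ⟧ ρ ∙ ⟦ f ⟧ ρ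
  ⟦ ⊝ e ⟧   ρ = ⟦ e ⟧ ρ ⁻¹

  Word : ℕ → Set
  Word n = List (Bool × Fin n)

  signed : Bool → Carrier → Carrier
  signed true  x = x
  signed false x = x ⁻¹

  ⟦_⟧ʷ : ∀ {n} → Word n → Vec Carrier n → Carrier
  ⟦ [] ⟧ʷ          ρ = ε
  ⟦ (b , i) ∷ w ⟧ʷ ρ = signed b (lookup ρ i) ∙ ⟦ w ⟧ʷ ρ

  push : ∀ {n} → Bool → Fin n → Word n → Word n
  push b i [] = (b , i) ∷ []
  push b i ((b′ , j) ∷ w) with i Fin.≟ j
  push true  i ((true  , j) ∷ w) | yes _ = (true , i) ∷ (true , j) ∷ w
  push true  i ((false , j) ∷ w) | yes _ = w
  push false i ((true  , j) ∷ w) | yes _ = w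
  push false i ((false , j) ∷ w) | yes _ = (false , i) ∷ (false , j) ∷ w
  push b     i ((b′    , j) ∷ w) | no  _ = (b , i) ∷ (b′ , j) ∷ w

  -- Puts `e`, or its inverse when `b` is `false`, in front of a word that is already reduced.
  -- Inversion reaches the variables by flipping the flag, and `push` only has to look for a
  -- cancellation at the head.
  multiply : ∀ {n} → Bool → Expr n → Word n → Word n
  multiply b     (var i) w = push b i w
  multiply b     𝟙       w = w
  multiply true  (e ⊕ f) w = multiply true e (multiply true f w)
  multiply false (e ⊕ f) w = multiply false f (multiply false e w)
  multiply b     (⊝ e)   w = multiply (not b) e w

  ⟦_⇓⟧ : ∀ {n} → Expr n → Vec Carrier n → Carrier
  ⟦ e ⇓⟧ = ⟦ multiply true e [] ⟧ʷ

  push-correct : ∀ {n} b (i : Fin n) w ρ →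
    ⟦ push b i w ⟧ʷ ρ ≈ signed b (lookup ρ i) ∙ ⟦ w ⟧ʷ ρ
  push-correct b i [] ρ = refl
  push-correct b i ((b′ , j) ∷ w) ρ with i Fin.≟ j
  push-correct true  i ((true  , j) ∷ w) ρ | yes _      = refl
  push-correct true  i ((false , j) ∷ w) ρ | yes ≡.refl = sym (\\-leftDividesˡ _ _)
  push-correct false i ((true  , j) ∷ w) ρ | yes ≡.refl = sym (\\-leftDividesʳ _ _)
  push-correct false i ((false , j) ∷ w) ρ | yes _      = refl
  push-correct b     i ((b′    , j) ∷ w) ρ | no  _      = refl

  multiply-correct : ∀ {n} b (e : Expr n) w ρ →
    ⟦ multiply b e w ⟧ʷ ρ ≈ signed b (⟦ e ⟧ ρ) ∙ ⟦ w ⟧ʷ ρ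
  multiply-correct b     (var i) w ρ = push-correct b i w ρ
  multiply-correct true  𝟙       w ρ = sym (identityˡ _)
  multiply-correct false 𝟙       w ρ = sym (trans (∙-congʳ ε⁻¹≈ε) (identityˡ _))
  multiply-correct true  (e ⊕ f) w ρ = begin
    ⟦ multiply true e (multiply true f w) ⟧ʷ ρ ≈⟨ multiply-correct true e _ ρ ⟩
    ⟦ e ⟧ ρ ∙ ⟦ multiply true f w ⟧ʷ ρ         ≈⟨ ∙-congˡ (multiply-correct true f w ρ) ⟩
    ⟦ e ⟧ ρ ∙ (⟦ f ⟧ ρ ∙ ⟦ w ⟧ʷ ρ)             ≈⟨ assoc _ _ _ ⟨
    ⟦ e ⟧ ρ ∙ ⟦ f ⟧ ρ ∙ ⟦ w ⟧ʷ ρ               ∎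
  multiply-correct false (e ⊕ f) w ρ = begin
    ⟦ multiply false f (multiply false e w) ⟧ʷ ρ ≈⟨ multiply-correct false f _ ρ ⟩
    ⟦ f ⟧ ρ ⁻¹ ∙ ⟦ multiply false e w ⟧ʷ ρ       ≈⟨ ∙-congˡ (multiply-correct false e w ρ) ⟩
    ⟦ f ⟧ ρ ⁻¹ ∙ (⟦ e ⟧ ρ ⁻¹ ∙ ⟦ w ⟧ʷ ρ)         ≈⟨ assoc _ _ _ ⟨
    ⟦ f ⟧ ρ ⁻¹ ∙ ⟦ e ⟧ ρ ⁻¹ ∙ ⟦ w ⟧ʷ ρ           ≈⟨ ∙-congʳ (⁻¹-anti-homo-∙ _ _) ⟨
    (⟦ e ⟧ ρ ∙ ⟦ f ⟧ ρ) ⁻¹ ∙ ⟦ w ⟧ʷ ρ            ∎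
  multiply-correct true  (⊝ e)   w ρ = multiply-correct false e w ρ
  multiply-correct false (⊝ e)   w ρ =
    trans (multiply-correct true e w ρ) (∙-congʳ (sym (⁻¹-involutive _)))

  open Reflection setoid var ⟦_⟧ ⟦_⇓⟧
    (λ e ρ → trans (multiply-correct true e [] ρ) (identityʳ _)) public
    using (solve; _⊜_)

module Powers {c ℓ} (G : Group c ℓ) where
  open Group G renaming (setoid to elements)
  open GroupProperties G
  open Mult monoid using (×-congʳ; ×-homo-+) renaming (_×_ to _·_)
  open GroupSolver G using (solve; _⊜_; _⊕_; ⊝_)
  open SetoidReasoning elements

  infixr 9 _^_

  _^_ : Carrier → ℤ → Carrier
  x ^ (+ n)    = n · x
  x ^ -[1+ n ] = (suc n · x) ⁻¹

  ^-cong : ∀ {x y} i → x ≈ y → x ^ i ≈ y ^ i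
  ^-cong (+ n)    x≈y = ×-congʳ n x≈y
  ^-cong -[1+ n ] x≈y = ⁻¹-cong (×-congʳ (suc n) x≈y)

  ^-congʳ : ∀ x {i j} → i ≡ j → x ^ i ≈ x ^ j
  ^-congʳ x ≡.refl = refl

  ·-comm : ∀ n x → x ∙ n · x ≈ n · x ∙ x
  ·-comm n x = begin
    x ∙ n · x        ≡⟨⟩
    suc n · x        ≡⟨ ≡.cong (_· x) (ℕ.+-comm 1 n) ⟩
    (n ℕ.+ 1) · x    ≈⟨ ×-homo-+ x n 1 ⟩
    n · x ∙ (x ∙ ε)  ≈⟨ ∙-congˡ (identityʳ x) ⟩
    n · x ∙ x        ∎

  -- Once `·-comm` has moved a factor `x` to the inner end of each power, the two factors cancel and
  -- both numbers drop by one.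
  ^-⊖ : ∀ x m n → x ^ (m ⊖ n) ≈ m · x ∙ (n · x) ⁻¹
  ^-⊖ x m       zero    = sym (trans (∙-congˡ ε⁻¹≈ε) (identityʳ _))
  ^-⊖ x zero    (suc n) = sym (identityˡ _)
  ^-⊖ x (suc m) (suc n) = begin
    x ^ (suc m ⊖ suc n)              ≡⟨ ≡.cong (x ^_) (ℤ.[1+m]⊖[1+n]≡m⊖n m n) ⟩
    x ^ (m ⊖ n)                      ≈⟨ ^-⊖ x m n ⟩
    m · x ∙ (n · x) ⁻¹               ≈⟨ solve 3 (λ x y z → y ⊕ ⊝ z ⊜ y ⊕ x ⊕ ⊝ (z ⊕ x)) refl x _ _ ⟩
    m · x ∙ x ∙ (n · x ∙ x) ⁻¹       ≈⟨ ∙-cong (·-comm m x) (⁻¹-cong (·-comm n x)) ⟨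
    x ∙ m · x ∙ (x ∙ n · x) ⁻¹       ∎

  ^-homo-+ : ∀ x i j → x ^ (i ℤ.+ j) ≈ x ^ i ∙ x ^ j
  ^-homo-+ x (+ m)    (+ n)    = ×-homo-+ x m n
  ^-homo-+ x (+ m)    -[1+ n ] = ^-⊖ x m (suc n)
  ^-homo-+ x -[1+ m ] (+ n)    = begin
    x ^ (n ⊖ suc m)           ≈⟨ ^-⊖ x n (suc m) ⟩
    -- `^-⊖` leaves the negative power on the right. Inserting a cancelling pair exposes a product
    -- of two positive powers; these commute, which moves the negative power to the left.
    n · x ∙ (suc m · x) ⁻¹    ≈⟨ solve 2 (λ y z → y ⊕ ⊝ z ⊜ ⊝ z ⊕ (z ⊕ y) ⊕ ⊝ z) refl _ _ ⟩
    (suc m · x) ⁻¹ ∙ (suc m · x ∙ n · x) ∙ (suc m · x) ⁻¹  ≈⟨ ∙-congʳ (∙-congˡ commute) ⟩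
    (suc m · x) ⁻¹ ∙ (n · x ∙ suc m · x) ∙ (suc m · x) ⁻¹  ≈⟨ solve 2 (λ y z → ⊝ z ⊕ (y ⊕ z) ⊕ ⊝ z ⊜ ⊝ z ⊕ y) refl _ _ ⟩
    (suc m · x) ⁻¹ ∙ n · x    ∎
    where
    commute : suc m · x ∙ n · x ≈ n · x ∙ suc m · x
    commute = trans (sym (×-homo-+ x (suc m) n))
      (trans (reflexive (≡.cong (_· x) (ℕ.+-comm (suc m) n))) (×-homo-+ x n (suc m)))
  ^-homo-+ x -[1+ m ] -[1+ n ] = begin
    (suc (suc (m ℕ.+ n)) · x) ⁻¹       ≡⟨ ≡.cong (λ k → (suc k · x) ⁻¹) (≡.trans (ℕ.+-suc n m) (≡.cong suc (ℕ.+-comm n m))) ⟨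
    ((suc n ℕ.+ suc m) · x) ⁻¹         ≈⟨ ⁻¹-cong (×-homo-+ x (suc n) (suc m)) ⟩
    (suc n · x ∙ suc m · x) ⁻¹         ≈⟨ ⁻¹-anti-homo-∙ _ _ ⟩
    (suc m · x) ⁻¹ ∙ (suc n · x) ⁻¹    ∎

  ^-homo-neg : ∀ x i → x ^ (ℤ.- i) ≈ (x ^ i) ⁻¹
  ^-homo-neg x i = inverseˡ-unique _ _
    (trans (sym (^-homo-+ x (ℤ.- i) i)) (^-congʳ x (ℤ.+-inverseˡ i)))

  ·-^ : ∀ x i n → n · (x ^ i) ≈ x ^ (+ n ℤ.* i)
  ·-^ x i zero    = refl
  ·-^ x i (suc n) = begin
    x ^ i ∙ n · (x ^ i)         ≈⟨ ∙-congˡ (·-^ x i n) ⟩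
    x ^ i ∙ x ^ (+ n ℤ.* i)     ≈⟨ ^-homo-+ x i _ ⟨
    x ^ (i ℤ.+ + n ℤ.* i)       ≡⟨ ≡.cong (x ^_) (ℤ.suc-* (+ n) i) ⟨
    x ^ (+ suc n ℤ.* i)         ∎

  ^-* : ∀ x i j → (x ^ i) ^ j ≈ x ^ (j ℤ.* i)
  ^-* x i (+ n)    = ·-^ x i n
  ^-* x i -[1+ n ] = begin
    (suc n · (x ^ i)) ⁻¹        ≈⟨ ⁻¹-cong (·-^ x i (suc n)) ⟩
    (x ^ (+ suc n ℤ.* i)) ⁻¹    ≈⟨ ^-homo-neg x (+ suc n ℤ.* i) ⟨
    x ^ (ℤ.- (+ suc n ℤ.* i))   ≡⟨ ≡.cong (x ^_) (ℤ.neg-distribˡ-* (+ suc n) i) ⟩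
    x ^ (-[1+ n ] ℤ.* i)        ∎

  -- Since `ε ^ 0ℤ` computes to `ε`, the law for iterated powers gives `ε` the exponent `i ℤ.* 0ℤ`.
  ε^ : ∀ {x} i → x ≈ ε → x ^ i ≈ ε
  ε^ {x} i x≈ε = trans (^-cong i x≈ε) (trans (^-* ε 0ℤ i) (^-congʳ ε (ℤ.*-zeroʳ i)))

  ^-1 : ∀ x → x ^ 1ℤ ≈ x
  ^-1 = identityʳ

  ·-conjugate : ∀ y x n → n · (y ∙ x ∙ y ⁻¹) ≈ y ∙ n · x ∙ y ⁻¹
  ·-conjugate y x zero    = sym (trans (∙-congʳ (identityʳ y)) (inverseʳ y))
  ·-conjugate y x (suc n) = trans (∙-congˡ (·-conjugate y x n))
    (solve 3 (λ x y z → y ⊕ x ⊕ ⊝ y ⊕ (y ⊕ z ⊕ ⊝ y) ⊜ y ⊕ (x ⊕ z) ⊕ ⊝ y) refl x y _)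

  ^-conjugate : ∀ y x i → (y ∙ x ∙ y ⁻¹) ^ i ≈ y ∙ x ^ i ∙ y ⁻¹
  ^-conjugate y x (+ n)    = ·-conjugate y x n
  ^-conjugate y x -[1+ n ] = trans (⁻¹-cong (·-conjugate y x (suc n)))
    (solve 2 (λ y z → ⊝ (y ⊕ z ⊕ ⊝ y) ⊜ y ⊕ ⊝ z ⊕ ⊝ y) refl y _)

  -- Placed at the level c ⊔ ℓ over which IsTarskiMonster quantifies.
  data Cyclic (x : Carrier) : Pred Carrier (c ⊔ ℓ) where
    power : ∀ i {y} → x ^ i ≈ y → y ∈ Cyclic x

  module _ {h} {H : Pred Carrier h} (isSubgroup : IsSubgroup G H) where
    open IsSubgroup isSubgroup

    ·-closed : ∀ {x} n → x ∈ H → n · x ∈ H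
    ·-closed zero    x∈H = ε-closed
    ·-closed (suc n) x∈H = ∙-closed x∈H (·-closed n x∈H)

    ^-closed : ∀ {x} i → x ∈ H → x ^ i ∈ H
    ^-closed (+ n)    x∈H = ·-closed n x∈H
    ^-closed -[1+ n ] x∈H = ⁻¹-closed (·-closed (suc n) x∈H)

    cyclic⊆ : ∀ {x} → x ∈ H → Cyclic x ⊆ H
    cyclic⊆ x∈H (power i eq) = respects eq (^-closed i x∈H)

  generator∈ : ∀ x → x ∈ Cyclic x
  generator∈ x = power 1ℤ (^-1 x)

  cyclic-isSubgroup : ∀ x → IsSubgroup G (Cyclic x)
  cyclic-isSubgroup x = record
    { respects  = λ { y≈z (power i eq) → power i (trans eq y≈z) }
    ; ε-closed  = power 0ℤ refl
    ; ∙-closed  = λ { (power i p) (power j q) → power (i ℤ.+ j) (trans (^-homo-+ x i j) (∙-cong p q)) }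
    ; ⁻¹-closed = λ { (power i p) → power (ℤ.- i) (trans (^-homo-neg x i) (⁻¹-cong p)) }
    }

  -- Division with remainder: the multiple of `n` in the exponent contributes a power of `ε`.
  finite-order : ∀ {x} n .{{_ : ℕ.NonZero n}} → x ^ (+ n) ≈ ε →
    ∀ {y} → y ∈ Cyclic x → ∃ λ (i : Fin n) → x ^ (+ toℕ i) ≈ y
  finite-order {x} n xⁿ≈ε {y} (power i eq) = fromℕ< r<n , (begin
    x ^ (+ toℕ (fromℕ< r<n))      ≡⟨ ≡.cong (λ r → x ^ (+ r)) (Fin.toℕ-fromℕ< r<n) ⟩
    x ^ (+ r)                     ≈⟨ identityʳ _ ⟨
    x ^ (+ r) ∙ ε                 ≈⟨ ∙-congˡ (trans (sym (^-* x (+ n) q)) (ε^ q xⁿ≈ε)) ⟨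
    x ^ (+ r) ∙ x ^ (q ℤ.* + n)   ≈⟨ ^-homo-+ x (+ r) (q ℤ.* + n) ⟨
    x ^ (+ r ℤ.+ q ℤ.* + n)       ≡⟨ ≡.cong (x ^_) (a≡a%ℕn+[a/ℕn]*n i n) ⟨
    x ^ i                         ≈⟨ eq ⟩
    y                             ∎)
    where
    r   = i %ℕ n
    q   = i /ℕ n
    r<n : r < n
    r<n = n%ℕd<d i n

-- Subgroups of Tarski monsters

module TarskiMonster (em : ∀ {a} → ExcludedMiddle a)
  {c ℓ} (G : Group c ℓ) (p : ℕ) (monster : IsTarskiMonster G p) where

  open Group G renaming (setoid to elements)
  open GroupProperties G
  open GroupSolver G using (solve; _⊜_; _⊕_; ⊝_; 𝟙)
  open Powers G
  open IsTarskiMonster monster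
  open FiniteSetoid
  open SetoidReasoning elements

  by-contradiction : ∀ {a} {P : Set a} → ¬ ¬ P → P
  by-contradiction = decidable-stable em

  -- The form in which infinitude of `G` is used throughout: a finite listing is already absurd when
  -- it has repetitions.
  ¬covered : ∀ {n} (f : Fin n → Carrier) → ¬ Covers elements f
  ¬covered f f-covers = infinite (covers⇒finite elements em _ f f-covers)

  ¬proper⇒universal : ∀ {h} {H : Pred Carrier h} → ¬ Proper G H → ∀ x → x ∈ H
  ¬proper⇒universal ¬proper x = by-contradiction λ x∉H → ¬proper (x , x∉H)

  ^-difference : ∀ x i j → x ^ i ≈ x ^ j → x ^ (i ℤ.- j) ≈ ε
  ^-difference x i j eq = begin
    x ^ (i ℤ.- j)         ≈⟨ ^-homo-+ x i (ℤ.- j) ⟩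
    x ^ i ∙ x ^ (ℤ.- j)   ≈⟨ ∙-cong eq (^-homo-neg x j) ⟩
    x ^ j ∙ (x ^ j) ⁻¹    ≈⟨ inverseʳ _ ⟩
    ε                     ∎

  ^-∣∣ : ∀ x i → x ^ i ≈ ε → x ^ (+ ∣ i ∣) ≈ ε
  ^-∣∣ x (+ n)    eq = eq
  ^-∣∣ x -[1+ n ] eq = ⁻¹-injective (trans eq (sym ε⁻¹≈ε))

  module _ {x} (x≉ε : x ≉ ε) where

    -- If `x` generated `G`, then `G` would be infinite cyclic, because torsion would leave only
    -- finitely many powers. The subgroup generated by x² would then be proper and nontrivial, hence
    -- of size `p`, although it contains infinitely many distinct powers.
    cyclic-proper : Proper G (Cyclic x)
    cyclic-proper = by-contradiction λ ¬proper → absurd (¬proper⇒universal ¬proper)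
      where
      module _ (all : ∀ y → y ∈ Cyclic x) where
        torsion-free : ∀ i → x ^ i ≈ ε → i ≡ 0ℤ
        torsion-free i eq with ∣ i ∣ in ∣i∣≡ | ^-∣∣ x i eq
        ... | zero  | _  = ℤ.∣i∣≡0⇒i≡0 ∣i∣≡
        ... | suc n | xⁿ≈ε = contradiction (λ y → finite-order (suc n) xⁿ≈ε (all y)) (¬covered λ i → x ^ (+ toℕ i))

        x² : Carrier
        x² = x ^ (+ 2)

        x²≉ε : x² ≉ ε
        x²≉ε eq with () ← torsion-free (+ 2) eq

        x∉ : x ∉ Cyclic x²
        x∉ (power k eq) = odd ∣ k ∣ (≡.trans (≡.sym (ℤ.abs-* k (+ 2))) (≡.cong ∣_∣ k*2≡1))
          where
          k*2≡1 : k ℤ.* + 2 ≡ 1ℤ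
          k*2≡1 = ℤ.i-j≡0⇒i≡j _ _ (torsion-free _ (^-difference x (k ℤ.* + 2) 1ℤ
            (trans (sym (^-* x (+ 2) k)) (trans eq (sym (^-1 x))))))

          odd : ∀ n → n ℕ.* 2 ≢ 1
          odd zero    ()
          odd (suc n) ()

        powers : Fin (suc p) → ∃ (Cyclic x²)
        powers i = x² ^ (+ toℕ i) , power (+ toℕ i) refl

        x²-injective : Injective _≡_ (Setoid._≈_ (elements ↾ Cyclic x²)) powers
        x²-injective {i} {j} eq = Fin.toℕ-injective (ℤ.+-injective (ℤ.*-cancelʳ-≡ _ _ (+ 2)
          (ℤ.i-j≡0⇒i≡j _ _ (torsion-free _ (^-difference x (+ toℕ i ℤ.* + 2) (+ toℕ j ℤ.* + 2)
            (trans (sym (^-* x (+ 2) (+ toℕ i))) (trans eq (^-* x (+ 2) (+ toℕ j)))))))))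

        absurd : ⊥
        absurd = contradiction
          (injection⇒≤ (elements ↾ Cyclic x²)
            (proj₂ (subgroups (Cyclic x²) (cyclic-isSubgroup x²) (x² , generator∈ x² , x²≉ε) (x , x∉)))
            {f = powers} x²-injective)
          ℕ.1+n≰n

    cyclic-size : HasSize p (elements ↾ Cyclic x)
    cyclic-size = proj₂ (subgroups (Cyclic x) (cyclic-isSubgroup x) (x , generator∈ x , x≉ε) cyclic-proper)

    -- If `∣ i ∣` were positive, fewer than `p` powers of `x` would exhaust the `p` elements of
    -- `Cyclic x`.
    ^-order : ∀ i → ∣ i ∣ < p → x ^ i ≈ ε → i ≡ 0ℤ
    ^-order i ∣i∣<p eq with ∣ i ∣ in ∣i∣≡ | ^-∣∣ x i eq
    ... | zero  | _  = ℤ.∣i∣≡0⇒i≡0 ∣i∣≡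
    ... | suc n | xⁿ≈ε = contradiction
      (covers⇒≥ (elements ↾ Cyclic x) cyclic-size
        {f = λ i → x ^ (+ toℕ i) , power (+ toℕ i) refl}
        (λ (y , y∈) → finite-order (suc n) xⁿ≈ε y∈))
      (ℕ.<⇒≱ ∣i∣<p)

    module _ {H : Pred Carrier (c ⊔ ℓ)} (H-isSubgroup : IsSubgroup G H) (x∈H : x ∈ H) where

      -- Both subgroups have `p` elements, so one more element of `H` outside `Cyclic x` would give
      -- `p` + 1 distinct elements of `H`.
      proper⇒⊆cyclic : Proper G H → H ⊆ Cyclic x
      proper⇒⊆cyclic proper {y} y∈H = by-contradiction λ y∉ →
        ℕ.1+n≰n (injection⇒≤ (elements ↾ H) H-size {f = insert} (insert-injective y∉))
        where
        H-size : HasSize p (elements ↾ H)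
        H-size = proj₂ (subgroups H H-isSubgroup (x , x∈H , x≉ε) proper)

        insert : Fin (suc p) → ∃ H
        insert zero    = y , y∈H
        insert (suc i) = let z , z∈ = enumerate _ cyclic-size i in z , cyclic⊆ H-isSubgroup x∈H z∈

        insert-injective : y ∉ Cyclic x → Injective _≡_ (Setoid._≈_ (elements ↾ H)) insert
        insert-injective y∉ {zero}  {zero}  eq = ≡.refl
        insert-injective y∉ {zero}  {suc j} eq = contradiction
          (IsSubgroup.respects (cyclic-isSubgroup x) (sym eq) (proj₂ (enumerate _ cyclic-size j))) y∉
        insert-injective y∉ {suc i} {zero}  eq = contradiction
          (IsSubgroup.respects (cyclic-isSubgroup x) eq (proj₂ (enumerate _ cyclic-size i))) y∉
        insert-injective y∉ {suc i} {suc j} eq = ≡.cong suc (Bijection.injective cyclic-size eq)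

      -- Maximality of `Cyclic x`, in the form used to show that a given subgroup is all of `G`.
      universal : ∀ {y} → y ∈ H → y ∉ Cyclic x → ∀ z → z ∈ H
      universal y∈H y∉ = ¬proper⇒universal λ proper → y∉ (proper⇒⊆cyclic proper y∈H)

  cyclic-sym : ∀ {x y} → x ≉ ε → y ≉ ε → y ∈ Cyclic x → x ∈ Cyclic y
  cyclic-sym x≉ε y≉ε y∈ =
    proper⇒⊆cyclic y≉ε (cyclic-isSubgroup _) y∈ (cyclic-proper x≉ε) (generator∈ _)

  -- The normaliser of `Cyclic x`. Conjugation by the inverse is included, so that closure under
  -- inverses amounts to swapping the components.
  Normalises : Carrier → Pred Carrier (c ⊔ ℓ)
  Normalises x y = y ∙ x ∙ y ⁻¹ ∈ Cyclic x × y ⁻¹ ∙ x ∙ y ⁻¹ ⁻¹ ∈ Cyclic x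

  conjugate-∈ : ∀ {x y z} → y ∙ x ∙ y ⁻¹ ∈ Cyclic x → z ∈ Cyclic x → y ∙ z ∙ y ⁻¹ ∈ Cyclic x
  conjugate-∈ {x} {y} yxy⁻¹∈ (power i eq) = IsSubgroup.respects (cyclic-isSubgroup x)
    (trans (^-conjugate y x i) (∙-congʳ (∙-congˡ eq)))
    (^-closed (cyclic-isSubgroup x) i yxy⁻¹∈)

  normaliser-isSubgroup : ∀ x → IsSubgroup G (Normalises x)
  normaliser-isSubgroup x = record
    { respects  = λ y≈z (l , r) →
        respects (conj-cong y≈z) l , respects (conj-cong (⁻¹-cong y≈z)) r
    ; ε-closed  =
        respects (solve 1 (λ x → x ⊜ 𝟙 ⊕ x ⊕ ⊝ 𝟙) refl x) (generator∈ x) ,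
        respects (solve 1 (λ x → x ⊜ ⊝ 𝟙 ⊕ x ⊕ ⊝ ⊝ 𝟙) refl x) (generator∈ x)
    ; ∙-closed  = λ {y} {z} (l , r) (l′ , r′) →
        respects (solve 3 (λ x y z → y ⊕ (z ⊕ x ⊕ ⊝ z) ⊕ ⊝ y ⊜ (y ⊕ z) ⊕ x ⊕ ⊝ (y ⊕ z)) refl x y z)
          (conjugate-∈ l l′) ,
        respects (solve 3 (λ x y z → ⊝ z ⊕ (⊝ y ⊕ x ⊕ ⊝ ⊝ y) ⊕ ⊝ ⊝ z ⊜ ⊝ (y ⊕ z) ⊕ x ⊕ ⊝ ⊝ (y ⊕ z)) refl x y z)
          (conjugate-∈ r′ r)
    ; ⁻¹-closed = λ {y} (l , r) →
        r , respects (solve 2 (λ x y → y ⊕ x ⊕ ⊝ y ⊜ ⊝ ⊝ y ⊕ x ⊕ ⊝ ⊝ ⊝ y) refl x y) l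
    }
    where
    respects = IsSubgroup.respects (cyclic-isSubgroup x)

    conj-cong : ∀ {y z} → y ≈ z → y ∙ x ∙ y ⁻¹ ≈ z ∙ x ∙ z ⁻¹
    conj-cong y≈z = ∙-cong (∙-congʳ y≈z) (⁻¹-cong y≈z)

  Product : Carrier → Carrier → Pred Carrier (c ⊔ ℓ)
  Product x y z = ∃₂ λ u v → u ∈ Cyclic x × v ∈ Cyclic y × u ∙ v ≈ z

  -- As `Cyclic x` is normal, u v u′ v′ regroups as u (v u′ v⁻¹) times v v′, and inverses regroup in
  -- the same way.
  product-isSubgroup : ∀ {x} y → (∀ z → Normalises x z) → IsSubgroup G (Product x y)
  product-isSubgroup {x} y normal = record
    { respects  = λ z≈w (u , v , u∈ , v∈ , eq) → u , v , u∈ , v∈ , trans eq z≈w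
    ; ε-closed  = ε , ε , X.ε-closed , Y.ε-closed , identityˡ ε
    ; ∙-closed  = λ (u , v , u∈ , v∈ , eq) (u′ , v′ , u′∈ , v′∈ , eq′) →
        u ∙ (v ∙ u′ ∙ v ⁻¹) , v ∙ v′ ,
        X.∙-closed u∈ (conjugate-∈ (proj₁ (normal v)) u′∈) , Y.∙-closed v∈ v′∈ ,
        trans (solve 4 (λ u v u′ v′ → u ⊕ (v ⊕ u′ ⊕ ⊝ v) ⊕ (v ⊕ v′) ⊜ u ⊕ v ⊕ (u′ ⊕ v′)) refl u v u′ v′)
              (∙-cong eq eq′)
    ; ⁻¹-closed = λ (u , v , u∈ , v∈ , eq) →
        v ⁻¹ ∙ u ⁻¹ ∙ v ⁻¹ ⁻¹ , v ⁻¹ ,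
        conjugate-∈ (proj₁ (normal (v ⁻¹))) (X.⁻¹-closed u∈) , Y.⁻¹-closed v∈ ,
        trans (solve 2 (λ u v → ⊝ v ⊕ ⊝ u ⊕ ⊝ ⊝ v ⊕ ⊝ v ⊜ ⊝ (u ⊕ v)) refl u v) (⁻¹-cong eq)
    }
    where
    module X = IsSubgroup (cyclic-isSubgroup x)
    module Y = IsSubgroup (cyclic-isSubgroup y)

  -- The product set has at most p² elements.
  product-¬universal : ∀ {x y} → x ≉ ε → y ≉ ε → ¬ (∀ z → z ∈ Product x y)
  product-¬universal {x} {y} x≉ε y≉ε all = ¬covered f f-covers
    where
    f : Fin (p ℕ.* p) → Carrier
    f k = let i , j = remQuot {p} p k in
      proj₁ (enumerate _ (cyclic-size x≉ε) i) ∙ proj₁ (enumerate _ (cyclic-size y≉ε) j)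

    f-covers : Covers elements f
    f-covers z =
      let u , v , u∈ , v∈ , eq = all z
          i , i-eq = enumerate-covers _ (cyclic-size x≉ε) (u , u∈)
          j , j-eq = enumerate-covers _ (cyclic-size y≉ε) (v , v∈)
      in combine i j , (begin
        f (combine i j)
          ≡⟨ ≡.cong (λ (i , j) → proj₁ (enumerate _ (cyclic-size x≉ε) i) ∙ proj₁ (enumerate _ (cyclic-size y≉ε) j))
               (Fin.remQuot-combine i j) ⟩
        proj₁ (enumerate _ (cyclic-size x≉ε) i) ∙ proj₁ (enumerate _ (cyclic-size y≉ε) j)
          ≈⟨ ∙-cong i-eq j-eq ⟩
        u ∙ v  ≈⟨ eq ⟩
        z      ∎)

  -- If `y` lay outside `Cyclic x`, the normaliser would be all of `G` by maximality. Then
  -- `Product x y` would be a subgroup containing `x` and `y`, hence again all of `G`, which its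
  -- finiteness forbids.
  self-normalising : ∀ {x y} → x ≉ ε → y ∙ x ∙ y ⁻¹ ∈ Cyclic x → y ∈ Cyclic x
  self-normalising {x} {y} x≉ε yxy⁻¹∈ = by-contradiction λ y∉ →
    let normal = universal x≉ε (normaliser-isSubgroup x) x-normalises y-normalises y∉
        y≉ε    = λ y≈ε → y∉ (X.respects (sym y≈ε) X.ε-closed)
    in product-¬universal x≉ε y≉ε (universal x≉ε (product-isSubgroup y normal)
         (x , ε , generator∈ x , IsSubgroup.ε-closed (cyclic-isSubgroup y) , identityʳ x)
         (ε , y , X.ε-closed , generator∈ y , identityˡ y) y∉)
    where
    module X = IsSubgroup (cyclic-isSubgroup x)

    x-normalises : Normalises x x
    x-normalises =
      X.respects (solve 1 (λ x → x ⊜ x ⊕ x ⊕ ⊝ x) refl x) (generator∈ x) ,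
      X.respects (solve 1 (λ x → x ⊜ ⊝ x ⊕ x ⊕ ⊝ ⊝ x) refl x) (generator∈ x)

    yxy⁻¹≉ε : y ∙ x ∙ y ⁻¹ ≉ ε
    yxy⁻¹≉ε eq = x≉ε (begin
      x                               ≈⟨ solve 2 (λ x y → x ⊜ ⊝ y ⊕ (y ⊕ x ⊕ ⊝ y) ⊕ y) refl x y ⟩
      y ⁻¹ ∙ (y ∙ x ∙ y ⁻¹) ∙ y       ≈⟨ ∙-congʳ (∙-congˡ eq) ⟩
      y ⁻¹ ∙ ε ∙ y                    ≈⟨ solve 1 (λ y → ⊝ y ⊕ 𝟙 ⊕ y ⊜ 𝟙) refl y ⟩
      ε                               ∎)

    y-normalises : Normalises x y
    -- Conjugation by `y ⁻¹` remains. The conjugate of `x` by `y` is a nontrivial element of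
    -- `Cyclic x`, so `x` is its `k`-th power, and `x ^ k` is the conjugate of `x` by `y ⁻¹`.
    y-normalises with cyclic-sym x≉ε yxy⁻¹≉ε yxy⁻¹∈
    ... | power k eq = yxy⁻¹∈ , power k (begin
      x ^ k                                       ≈⟨ solve 2 (λ y z → z ⊜ ⊝ y ⊕ (y ⊕ z ⊕ ⊝ y) ⊕ ⊝ ⊝ y) refl y (x ^ k) ⟩
      y ⁻¹ ∙ (y ∙ x ^ k ∙ y ⁻¹) ∙ y ⁻¹ ⁻¹         ≈⟨ ∙-congʳ (∙-congˡ (trans (sym (^-conjugate y x k)) eq)) ⟩
      y ⁻¹ ∙ x ∙ y ⁻¹ ⁻¹                          ∎)

-- The graph on the neighbours of a vertex

module Letters where
  open import Relation.Binary.PropositionalEquality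

  module _ {n} (A : Fin n → Fin n → ℕ) where
    open Sum ℕ.+-0-commutativeMonoid using (sum; sum-permute; sum-cong-≗)

    walks : ℕ → Fin n → ℕ
    walks zero    i = 1
    walks (suc k) i = sum λ j → A i j ℕ.* walks k j

    module _ (π : Permutation′ n) (A-invariant : ∀ i j → A (π ⟨$⟩ʳ i) (π ⟨$⟩ʳ j) ≡ A i j) where

      -- Induction on the length: applying `π` to the starting vertex only permutes the summands.
      walks-invariant : ∀ k i → walks k (π ⟨$⟩ʳ i) ≡ walks k i
      walks-invariant zero    i = refl
      walks-invariant (suc k) i = trans
        (sum-permute (λ j → A (π ⟨$⟩ʳ i) j ℕ.* walks k j) π)
        (sum-cong-≗ λ j → cong₂ ℕ._*_ (A-invariant i j) (walks-invariant k j))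

  data Family : Set where
    𝐚 𝐛 𝐜 : Family

  infix 4 _≟ᶠ_
  _≟ᶠ_ : DecidableEquality Family
  𝐚 ≟ᶠ 𝐚 = yes refl
  𝐚 ≟ᶠ 𝐛 = no λ ()
  𝐚 ≟ᶠ 𝐜 = no λ ()
  𝐛 ≟ᶠ 𝐚 = no λ ()
  𝐛 ≟ᶠ 𝐛 = yes refl
  𝐛 ≟ᶠ 𝐜 = no λ ()
  𝐜 ≟ᶠ 𝐚 = no λ ()
  𝐜 ≟ᶠ 𝐛 = no λ ()
  𝐜 ≟ᶠ 𝐜 = yes refl

  -- (f , i) stands for the i-th power of the generator of family f.
  Letter : Set
  Letter = Family × ℤ

  infix 4 _≟ˡ_
  _≟ˡ_ : DecidableEquality Letter
  _≟ˡ_ = ×-≡-dec _≟ᶠ_ ℤ._≟_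

  infix 8 _⁻
  _⁻ : Letter → Letter
  (f , i) ⁻ = f , ℤ.- i

  -- The cases of `relator-complete`: three equal families, exactly two equal families in each
  -- position, and the two cyclic orders of three different families with their rotations.
  data View : Family → Family → Family → Set where
    fff : ∀ {f}   → View f f f
    ffg : ∀ {f g} → f ≢ g → View f f g
    fgf : ∀ {f g} → f ≢ g → View f g f
    gff : ∀ {f g} → f ≢ g → View g f f
    abc : View 𝐚 𝐛 𝐜
    bca : View 𝐛 𝐜 𝐚
    cab : View 𝐜 𝐚 𝐛
    acb : View 𝐚 𝐜 𝐛
    cba : View 𝐜 𝐛 𝐚
    bac : View 𝐛 𝐚 𝐜

  view : ∀ f g h → View f g h
  view f g h with f ≟ᶠ g | g ≟ᶠ h | h ≟ᶠ f
  view f g h | yes refl | yes refl | _        = fff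
  view f g h | yes refl | no f≢h   | _        = ffg f≢h
  view f g h | no f≢g   | _        | yes refl = fgf f≢g
  view f g h | no f≢g   | yes refl | _        = gff (f≢g ∘ sym)
  view 𝐚 𝐛 𝐜 | no _ | no _ | no _ = abc
  view 𝐛 𝐜 𝐚 | no _ | no _ | no _ = bca
  view 𝐜 𝐚 𝐛 | no _ | no _ | no _ = cab
  view 𝐚 𝐜 𝐛 | no _ | no _ | no _ = acb
  view 𝐜 𝐛 𝐚 | no _ | no _ | no _ = cba
  view 𝐛 𝐚 𝐜 | no _ | no _ | no _ = bac
  view 𝐚 𝐚 _ | no f≢f | _ | _ = contradiction refl f≢f
  view 𝐛 𝐛 _ | no f≢f | _ | _ = contradiction refl f≢f
  view 𝐜 𝐜 _ | no f≢f | _ | _ = contradiction refl f≢f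
  view 𝐚 𝐛 𝐚 | no _ | _ | no f≢f = contradiction refl f≢f
  view 𝐚 𝐛 𝐛 | no _ | no f≢f | _ = contradiction refl f≢f
  view 𝐚 𝐜 𝐚 | no _ | _ | no f≢f = contradiction refl f≢f
  view 𝐚 𝐜 𝐜 | no _ | no f≢f | _ = contradiction refl f≢f
  view 𝐛 𝐚 𝐚 | no _ | no f≢f | _ = contradiction refl f≢f
  view 𝐛 𝐚 𝐛 | no _ | _ | no f≢f = contradiction refl f≢f
  view 𝐛 𝐜 𝐛 | no _ | _ | no f≢f = contradiction refl f≢f
  view 𝐛 𝐜 𝐜 | no _ | no f≢f | _ = contradiction refl f≢f
  view 𝐜 𝐚 𝐚 | no _ | no f≢f | _ = contradiction refl f≢f
  view 𝐜 𝐚 𝐜 | no _ | _ | no f≢f = contradiction refl f≢f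
  view 𝐜 𝐛 𝐛 | no _ | no f≢f | _ = contradiction refl f≢f
  view 𝐜 𝐛 𝐜 | no _ | _ | no f≢f = contradiction refl f≢f

  Triple : Set
  Triple = Letter × Letter × Letter

  -- The rotations of the relation a³b²c⁻¹ = 1 and of its inverse.
  mixedRelators : List Triple
  mixedRelators =
    ((𝐚 , + 3) , (𝐛 , + 2) , (𝐜 , -1ℤ)) ∷
    ((𝐛 , + 2) , (𝐜 , -1ℤ) , (𝐚 , + 3)) ∷
    ((𝐜 , -1ℤ) , (𝐚 , + 3) , (𝐛 , + 2)) ∷
    ((𝐚 , -[1+ 2 ]) , (𝐜 , 1ℤ) , (𝐛 , -[1+ 1 ])) ∷
    ((𝐜 , 1ℤ) , (𝐛 , -[1+ 1 ]) , (𝐚 , -[1+ 2 ])) ∷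
    ((𝐛 , -[1+ 1 ]) , (𝐚 , -[1+ 2 ]) , (𝐜 , 1ℤ)) ∷ []

  -- A description, free of the group and decidable, of the triples of letters whose values multiply
  -- to 1. `relator-sound` and `relator-complete` compare it with `G`.
  Relator : Letter → Letter → Letter → Set
  Relator s@(f , i) t@(g , j) u@(h , k) =
    (f ≡ g × g ≡ h × i ℤ.+ j ℤ.+ k ≡ 0ℤ) ⊎ (s , t , u) ∈ˡ mixedRelators

  relator? : ∀ s t u → Dec (Relator s t u)
  relator? s@(f , i) t@(g , j) u@(h , k) =
    ((f ≟ᶠ g) ×-dec (g ≟ᶠ h) ×-dec (i ℤ.+ j ℤ.+ k ℤ.≟ 0ℤ)) ⊎-dec
    ∈-dec (×-≡-dec _≟ˡ_ (×-≡-dec _≟ˡ_ _≟ˡ_)) (s , t , u) mixedRelators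

  letters : Vec Letter 12
  letters =
    (𝐚 , + 1) ∷ (𝐚 , + 2) ∷ (𝐚 , + 3) ∷ (𝐚 , -[1+ 0 ]) ∷ (𝐚 , -[1+ 1 ]) ∷ (𝐚 , -[1+ 2 ]) ∷
    (𝐛 , + 1) ∷ (𝐛 , + 2) ∷ (𝐛 , -[1+ 0 ]) ∷ (𝐛 , -[1+ 1 ]) ∷
    (𝐜 , + 1) ∷ (𝐜 , -[1+ 0 ]) ∷ []

  letter : Fin 12 → Letter
  letter = lookup letters

  -- What the comparison with `G` uses about a letter. The bound 3 is shared by all families to keep
  -- it uniform; it is coarser than the actual exponents for 𝐛.
  record Small (s : Letter) : Set where
    constructor small
    field
      bounded : ∣ proj₂ s ∣ ≤ 3
      nonzero : proj₂ s ≢ 0ℤ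
      c-unit  : proj₁ s ≡ 𝐜 → proj₂ s ≡ 1ℤ ⊎ proj₂ s ≡ -1ℤ

  small? : ∀ s → Dec (Small s)
  small? (f , i) = map′ (λ (b , n , u) → small b n u) (λ (small b n u) → b , n , u)
    ((∣ i ∣ ℕ.≤? 3) ×-dec ¬? (i ℤ.≟ 0ℤ) ×-dec ((f ≟ᶠ 𝐜) →-dec ((i ℤ.≟ 1ℤ) ⊎-dec (i ℤ.≟ -1ℤ))))

  small-⁻ : ∀ {s} → Small s → Small (s ⁻)
  small-⁻ {f , i} (small bounded nonzero c-unit) = small
    (subst (_≤ 3) (sym (ℤ.∣-i∣≡∣i∣ i)) bounded)
    (nonzero ∘ ℤ.neg-injective)
    (λ f≡𝐜 → case c-unit f≡𝐜 of λ { (inj₁ refl) → inj₂ refl ; (inj₂ refl) → inj₁ refl })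

  letter-small : ∀ i → Small (letter i)
  letter-small = from-yes (Fin.all? (small? ∘ letter))

  letter-injective : ∀ i j → letter i ≡ letter j → i ≡ j
  letter-injective = from-yes (Fin.all? λ i → Fin.all? λ j → (letter i ≟ˡ letter j) →-dec (i Fin.≟ j))

  letter-inverse : ∀ i → ∃ λ j → letter j ≡ letter i ⁻
  letter-inverse = from-yes (Fin.all? λ i → Fin.any? λ j → letter j ≟ˡ letter i ⁻)

  -- Two neighbours of a vertex are joined if s⁻¹t is a generator u, which is written here as the
  -- relation s⁻¹tu⁻¹ = 1.
  Adjacent : Fin 12 → Fin 12 → Set
  Adjacent i j = ∃ λ k → Relator (letter i ⁻) (letter j) (letter k ⁻)

  adjacent? : ∀ i j → Dec (Adjacent i j)
  adjacent? i j = Fin.any? λ k → relator? (letter i ⁻) (letter j) (letter k ⁻)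

  adjacency : Fin 12 → Fin 12 → ℕ
  adjacency i j = if does (adjacent? i j) then 1 else 0

  -- Tabulated so that counting walks evaluates numerals instead of searching for relators.
  adjacencyMatrix : Vec (Vec ℕ 12) 12
  adjacencyMatrix =
    (0 ∷ 1 ∷ 1 ∷ 1 ∷ 1 ∷ 0 ∷ 0 ∷ 0 ∷ 0 ∷ 0 ∷ 0 ∷ 0 ∷ []) ∷
    (1 ∷ 0 ∷ 1 ∷ 1 ∷ 0 ∷ 0 ∷ 0 ∷ 0 ∷ 0 ∷ 0 ∷ 0 ∷ 0 ∷ []) ∷
    (1 ∷ 1 ∷ 0 ∷ 0 ∷ 0 ∷ 0 ∷ 0 ∷ 0 ∷ 0 ∷ 0 ∷ 1 ∷ 0 ∷ []) ∷
    (1 ∷ 1 ∷ 0 ∷ 0 ∷ 1 ∷ 1 ∷ 0 ∷ 0 ∷ 0 ∷ 0 ∷ 0 ∷ 0 ∷ []) ∷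
    (1 ∷ 0 ∷ 0 ∷ 1 ∷ 0 ∷ 1 ∷ 0 ∷ 0 ∷ 0 ∷ 0 ∷ 0 ∷ 0 ∷ []) ∷
    (0 ∷ 0 ∷ 0 ∷ 1 ∷ 1 ∷ 0 ∷ 0 ∷ 1 ∷ 0 ∷ 0 ∷ 0 ∷ 0 ∷ []) ∷
    (0 ∷ 0 ∷ 0 ∷ 0 ∷ 0 ∷ 0 ∷ 0 ∷ 1 ∷ 1 ∷ 0 ∷ 0 ∷ 0 ∷ []) ∷
    (0 ∷ 0 ∷ 0 ∷ 0 ∷ 0 ∷ 1 ∷ 1 ∷ 0 ∷ 0 ∷ 0 ∷ 0 ∷ 0 ∷ []) ∷
    (0 ∷ 0 ∷ 0 ∷ 0 ∷ 0 ∷ 0 ∷ 1 ∷ 0 ∷ 0 ∷ 1 ∷ 0 ∷ 0 ∷ []) ∷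
    (0 ∷ 0 ∷ 0 ∷ 0 ∷ 0 ∷ 0 ∷ 0 ∷ 0 ∷ 1 ∷ 0 ∷ 0 ∷ 1 ∷ []) ∷
    (0 ∷ 0 ∷ 1 ∷ 0 ∷ 0 ∷ 0 ∷ 0 ∷ 0 ∷ 0 ∷ 0 ∷ 0 ∷ 0 ∷ []) ∷
    (0 ∷ 0 ∷ 0 ∷ 0 ∷ 0 ∷ 0 ∷ 0 ∷ 0 ∷ 0 ∷ 1 ∷ 0 ∷ 0 ∷ []) ∷
    []

  adjacency-matrix : ∀ i j → adjacency i j ≡ lookup (lookup adjacencyMatrix i) j
  adjacency-matrix = from-yes (Fin.all? λ i → Fin.all? λ j →
    adjacency i j ℕ.≟ lookup (lookup adjacencyMatrix i) j)

  -- Length 3 is the shortest that separates all vertices: `a` and its inverse both start 13 walks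
  -- of length 2.
  walks₃ : Vec ℕ 12
  walks₃ = 43 ∷ 34 ∷ 27 ∷ 44 ∷ 35 ∷ 29 ∷ 9 ∷ 13 ∷ 7 ∷ 6 ∷ 8 ∷ 3 ∷ []

  walks₃-correct : ∀ i → walks (λ i j → lookup (lookup adjacencyMatrix i) j) 3 i ≡ lookup walks₃ i
  walks₃-correct = from-yes (Fin.all? λ i →
    walks (λ i j → lookup (lookup adjacencyMatrix i) j) 3 i ℕ.≟ lookup walks₃ i)

  walks₃-injective : ∀ i j → lookup walks₃ i ≡ lookup walks₃ j → i ≡ j
  walks₃-injective = from-yes (Fin.all? λ i → Fin.all? λ j →
    (lookup walks₃ i ℕ.≟ lookup walks₃ j) →-dec (i Fin.≟ j))

  rigid : (π : Permutation′ 12) →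
    (∀ i j → Adjacent (π ⟨$⟩ʳ i) (π ⟨$⟩ʳ j) ⇔ Adjacent i j) → ∀ i → π ⟨$⟩ʳ i ≡ i
  rigid π π-iso i = walks₃-injective _ _ (begin
    lookup walks₃ (π ⟨$⟩ʳ i)  ≡⟨ walks₃-correct (π ⟨$⟩ʳ i) ⟨
    walks M 3 (π ⟨$⟩ʳ i)      ≡⟨ walks-invariant M π M-invariant 3 i ⟩
    walks M 3 i               ≡⟨ walks₃-correct i ⟩
    lookup walks₃ i           ∎)
    where
    open ≡-Reasoning

    M : Fin 12 → Fin 12 → ℕ
    M i j = lookup (lookup adjacencyMatrix i) j

    M-invariant : ∀ i j → M (π ⟨$⟩ʳ i) (π ⟨$⟩ʳ j) ≡ M i j
    M-invariant i j = begin
      M (π ⟨$⟩ʳ i) (π ⟨$⟩ʳ j)          ≡⟨ adjacency-matrix (π ⟨$⟩ʳ i) (π ⟨$⟩ʳ j) ⟨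
      adjacency (π ⟨$⟩ʳ i) (π ⟨$⟩ʳ j)  ≡⟨ cong (if_then 1 else 0) (does-⇔ (π-iso i j) (adjacent? (π ⟨$⟩ʳ i) (π ⟨$⟩ʳ j)) (adjacent? i j)) ⟩
      adjacency i j                    ≡⟨ adjacency-matrix i j ⟩
      M i j                            ∎

open Letters

-- A generic pair of elements

module Generators (em : ∀ {a} → ExcludedMiddle a)
  {c ℓ} (G : Group c ℓ) (p : ℕ) (monster : IsTarskiMonster G p) (p>263 : p > 263) where

  open Group G renaming (setoid to elements)
  open GroupProperties G
  open GroupSolver G using (solve; _⊜_; _⊕_; ⊝_; 𝟙)
  open Powers G
  open TarskiMonster em G p monster
  open SetoidReasoning elements

  -- The numerals compared with `p` below are at most 32, so the implicit comparison with 263 is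
  -- settled by evaluation.
  <p : ∀ {m} n {_ : True (n ℕ.≤? 263)} → m ≤ n → m < p
  <p n {n≤263} m≤n = ℕ.≤-<-trans (ℕ.≤-trans m≤n (toWitness n≤263)) p>263

  cyclic-respects : ∀ {x y z} → y ≈ z → y ∈ Cyclic x → z ∈ Cyclic x
  cyclic-respects {x} = IsSubgroup.respects (cyclic-isSubgroup x)

  cyclic-trans : ∀ {x y z} → x ∈ Cyclic y → y ∈ Cyclic z → x ∈ Cyclic z
  cyclic-trans {z = z} x∈ y∈ = cyclic⊆ (cyclic-isSubgroup z) y∈ x∈

  -- A common element `z` other than `ε` would generate both subgroups.
  cyclic-disjoint : ∀ {x y z} → x ≉ ε → y ≉ ε → y ∉ Cyclic x →
    z ∈ Cyclic x → z ∈ Cyclic y → z ≈ ε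
  cyclic-disjoint x≉ε y≉ε y∉ z∈x z∈y = by-contradiction λ z≉ε →
    y∉ (cyclic-trans (cyclic-sym y≉ε z≉ε z∈y) z∈x)

  ^-injective : ∀ {x} → x ≉ ε → ∀ i j → ∣ i ∣ ℕ.+ ∣ j ∣ < p → x ^ i ≈ x ^ j → i ≡ j
  ^-injective {x} x≉ε i j bound eq = ℤ.i-j≡0⇒i≡j i j
    (^-order x≉ε (i ℤ.- j) (ℕ.≤-trans (s≤s (ℤ.∣i-j∣≤∣i∣+∣j∣ i j)) bound) (^-difference x i j eq))

  -- If u y² vₖ and u y′² vₖ both lie in the cyclic subgroup C, then u conjugates y² y′⁻² into C;
  -- so each k rules out at most one y.
  avoid : ∀ {u y₀} → y₀ ≉ ε → u ∉ Cyclic y₀ → ∀ n (v : Fin n → Carrier) →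
    suc n ℕ.* 4 < p →
    ∃ λ y → y ∈ Cyclic y₀ × y ≉ ε × (∀ k → u ∙ y ^ (+ 2) ∙ v k ∉ Cyclic y₀)
  avoid {u} {y₀} y₀≉ε u∉ n v bound =
    let i , ¬bad = Fin.¬∀⟶∃¬ (suc n) Bad (λ _ → em) ¬all-bad
    in y i , power (e i) refl , y≉ε i , λ k k∈ → ¬bad (k , k∈)
    where
    e : Fin (suc n) → ℤ
    -- The exponents run from 1 to `n` + 1: one more than there are `v k`, for the pigeonhole
    -- principle, and none of them zero. Two of them, doubled, add up to at most 4(`n` + 1), whence
    -- the bound on `p`.
    e i = + suc (toℕ i)

    y : Fin (suc n) → Carrier
    y i = y₀ ^ e i

    Bad : Fin (suc n) → Set _
    Bad i = ∃ λ k → u ∙ y i ^ (+ 2) ∙ v k ∈ Cyclic y₀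

    2e≤ : ∀ i → ∣ + 2 ℤ.* e i ∣ ≤ suc n ℕ.* 2
    2e≤ i = ≡.subst (_≤ suc n ℕ.* 2) (≡.trans (ℕ.*-comm (suc (toℕ i)) 2) (≡.sym (ℤ.abs-* (+ 2) (e i))))
      (ℕ.*-monoˡ-≤ 2 (Fin.toℕ<n i))

    y²-injective : ∀ i j → y i ^ (+ 2) ≈ y j ^ (+ 2) → i ≡ j
    y²-injective i j eq = Fin.toℕ-injective (ℕ.suc-injective (ℤ.+-injective (ℤ.*-cancelˡ-≡ (+ 2) _ _
      (^-injective y₀≉ε (+ 2 ℤ.* e i) (+ 2 ℤ.* e j)
        (ℕ.≤-<-trans (ℕ.+-mono-≤ (2e≤ i) (2e≤ j))
          (≡.subst (_< p) (ℕ.*-distribˡ-+ (suc n) 2 2) bound))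
        (trans (sym (^-* y₀ (e i) (+ 2))) (trans eq (^-* y₀ (e j) (+ 2))))))))

    y≉ε : ∀ i → y i ≉ ε
    y≉ε i eq with () ← ^-injective y₀≉ε (e i) 0ℤ
      (ℕ.≤-<-trans (ℕ.≤-trans (ℕ.≤-reflexive (ℕ.+-identityʳ _)) (ℕ.≤-trans (Fin.toℕ<n i) (ℕ.m≤m*n (suc n) 4))) bound)
      eq

    open IsSubgroup (cyclic-isSubgroup y₀)

    y²∈ : ∀ i → y i ^ (+ 2) ∈ Cyclic y₀
    y²∈ i = power (+ 2 ℤ.* e i) (sym (^-* y₀ (e i) (+ 2)))

    collision : ∀ {i j k} → i ≢ j → u ∙ y i ^ (+ 2) ∙ v k ∈ Cyclic y₀ → ¬ (u ∙ y j ^ (+ 2) ∙ v k ∈ Cyclic y₀)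
    -- `w` is a nontrivial element of `Cyclic y₀` and hence generates it. As `u` conjugates `w` into
    -- this subgroup, self-normalisation puts `u` there too.
    collision {i} {j} {k} i≢j i∈ j∈ = u∉ (cyclic-trans
      (self-normalising w≉ε (cyclic-trans uwu⁻¹∈ (cyclic-sym y₀≉ε w≉ε w∈))) w∈)
      where
      w : Carrier
      w = y i ^ (+ 2) ∙ (y j ^ (+ 2)) ⁻¹

      w∈ : w ∈ Cyclic y₀
      w∈ = ∙-closed (y²∈ i) (⁻¹-closed (y²∈ j))

      w≉ε : w ≉ ε
      w≉ε eq = i≢j (y²-injective i j (x∙y⁻¹≈ε⇒x≈y _ _ eq))

      uwu⁻¹∈ : u ∙ w ∙ u ⁻¹ ∈ Cyclic y₀
      uwu⁻¹∈ = respects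
        (solve 4 (λ u y z v → u ⊕ y ⊕ v ⊕ ⊝ (u ⊕ z ⊕ v) ⊜ u ⊕ (y ⊕ ⊝ z) ⊕ ⊝ u) refl u _ _ (v k))
        (∙-closed i∈ (⁻¹-closed j∈))

    ¬all-bad : ¬ (∀ i → Bad i)
    ¬all-bad bad with Fin.pigeonhole ℕ.≤-refl (proj₁ ∘ bad)
    ... | i , j , i<j , k≡ = collision (Fin.<⇒≢ i<j) (proj₂ (bad i))
      (≡.subst (λ k → u ∙ y j ^ (+ 2) ∙ v k ∈ Cyclic y₀) (≡.sym k≡) (proj₂ (bad j)))

  small-exponent : ∀ i → ∣ i ∣ ≤ 3 → ∃ λ (k : Fin 7) → toℕ k ⊖ 3 ≡ i
  small-exponent (+ 0)    _ = 3F , ≡.refl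
  small-exponent (+ 1)    _ = 4F , ≡.refl
  small-exponent (+ 2)    _ = 5F , ≡.refl
  small-exponent (+ 3)    _ = 6F , ≡.refl
  small-exponent -[1+ 0 ] _ = 2F , ≡.refl
  small-exponent -[1+ 1 ] _ = 1F , ≡.refl
  small-exponent -[1+ 2 ] _ = 0F , ≡.refl
  small-exponent (+ suc (suc (suc (suc _)))) (s≤s (s≤s (s≤s ())))
  small-exponent -[1+ suc (suc (suc _)) ]    (s≤s (s≤s (s≤s ())))

  -- With c = a³b², the field `generic` excludes the relations aⁱbʲc = 1 and aⁱc⁻¹bʲ = 1 for small
  -- `i`.
  record GenericPair : Set (c ⊔ ℓ) where
    field
      a b      : Carrier
      a≉ε      : a ≉ ε
      b≉ε      : b ≉ ε
      b∉⟨a⟩    : b ∉ Cyclic a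
      generic  : ∀ i → ∣ i ∣ ≤ 3 → a ^ (+ 3) ∙ b ^ (+ 2) ∙ a ^ i ∉ Cyclic b

  nontrivial : ∃ λ x → x ≉ ε
  nontrivial = by-contradiction λ ¬∃ → ¬covered {1} (λ _ → ε)
    λ x → zero , by-contradiction λ ε≉x → ¬∃ (x , ε≉x ∘ sym)

  module _ {a b₀} (a≉ε : a ≉ ε) (b₀∉⟨a⟩ : b₀ ∉ Cyclic a) where
    b₀≉ε : b₀ ≉ ε
    b₀≉ε b₀≈ε = b₀∉⟨a⟩ (power 0ℤ (sym b₀≈ε))

    a³∉⟨b₀⟩ : a ^ (+ 3) ∉ Cyclic b₀
    a³∉⟨b₀⟩ a³∈ = contradiction
      (^-injective a≉ε (+ 3) 0ℤ (<p 3 ℕ.≤-refl)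
        (cyclic-disjoint a≉ε b₀≉ε b₀∉⟨a⟩ (power (+ 3) refl) a³∈))
      λ ()

    extend : (∃ λ b → b ∈ Cyclic b₀ × b ≉ ε ×
      (∀ (k : Fin 7) → a ^ (+ 3) ∙ b ^ (+ 2) ∙ a ^ (toℕ k ⊖ 3) ∉ Cyclic b₀)) → GenericPair
    extend (b , b∈⟨b₀⟩ , b≉ε , b-generic) = record
      { a = a ; b = b ; a≉ε = a≉ε ; b≉ε = b≉ε
      ; b∉⟨a⟩ = λ b∈⟨a⟩ → b₀∉⟨a⟩ (cyclic-trans (cyclic-sym b₀≉ε b≉ε b∈⟨b₀⟩) b∈⟨a⟩)
      ; generic = λ i ∣i∣≤3 ∈⟨b⟩ → let k , eq = small-exponent i ∣i∣≤3 in
          b-generic k (≡.subst (λ i → a ^ (+ 3) ∙ b ^ (+ 2) ∙ a ^ i ∈ Cyclic b₀) (≡.sym eq)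
            (cyclic-trans ∈⟨b⟩ b∈⟨b₀⟩))
      }

  genericPair : GenericPair
  genericPair =
    let a , a≉ε = nontrivial
        b₀ , b₀∉⟨a⟩ = cyclic-proper a≉ε
    in extend a≉ε b₀∉⟨a⟩
      -- There is one `k` for each exponent from -3 to 3, and 32 is (7 + 1) times 4.
      (avoid (b₀≉ε a≉ε b₀∉⟨a⟩) (a³∉⟨b₀⟩ a≉ε b₀∉⟨a⟩) 7 (λ k → a ^ (toℕ k ⊖ 3)) (<p 32 ℕ.≤-refl))

  -- Relations of length three between the generators

  module Link (pair : GenericPair) where
    open GenericPair pair

    base : Family → Carrier
    base 𝐚 = a
    base 𝐛 = b
    base 𝐜 = a ^ (+ 3) ∙ b ^ (+ 2)

    value : Letter → Carrier
    value (f , i) = base f ^ i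

    private
      A = a ^ (+ 3)
      B = b ^ (+ 2)

    A≉ε : A ≉ ε
    A≉ε eq = contradiction (^-injective a≉ε (+ 3) 0ℤ (<p 3 ℕ.≤-refl) eq) λ ()

    B≉ε : B ≉ ε
    B≉ε eq = contradiction (^-injective b≉ε (+ 2) 0ℤ (<p 2 ℕ.≤-refl) eq) λ ()

    a∩b : ∀ {z} → z ∈ Cyclic a → z ∈ Cyclic b → z ≈ ε
    a∩b = cyclic-disjoint a≉ε b≉ε b∉⟨a⟩

    c∉⟨a⟩ : base 𝐜 ∉ Cyclic a
    c∉⟨a⟩ c∈ = B≉ε (a∩b
      (cyclic-respects (\\-leftDividesʳ A B)
        (IsSubgroup.∙-closed (cyclic-isSubgroup a)
          (IsSubgroup.⁻¹-closed (cyclic-isSubgroup a) (power (+ 3) refl)) c∈))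
      (power (+ 2) refl))

    c∉⟨b⟩ : base 𝐜 ∉ Cyclic b
    c∉⟨b⟩ c∈ = A≉ε (a∩b (power (+ 3) refl)
      (cyclic-respects (//-rightDividesʳ B A)
        (IsSubgroup.∙-closed (cyclic-isSubgroup b) c∈
          (IsSubgroup.⁻¹-closed (cyclic-isSubgroup b) (power (+ 2) refl)))))

    c≉ε : base 𝐜 ≉ ε
    c≉ε c≈ε = c∉⟨a⟩ (power 0ℤ (sym c≈ε))

    base≉ε : ∀ f → base f ≉ ε
    base≉ε 𝐚 = a≉ε
    base≉ε 𝐛 = b≉ε
    base≉ε 𝐜 = c≉ε

    base-disjoint : ∀ f g {z} → f ≢ g → z ∈ Cyclic (base f) → z ∈ Cyclic (base g) → z ≈ ε
    base-disjoint 𝐚 𝐚 f≢g _  _  = contradiction ≡.refl f≢g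
    base-disjoint 𝐚 𝐛 _   z∈ z∈′ = a∩b z∈ z∈′
    base-disjoint 𝐚 𝐜 _   z∈ z∈′ = cyclic-disjoint a≉ε c≉ε c∉⟨a⟩ z∈ z∈′
    base-disjoint 𝐛 𝐚 _   z∈ z∈′ = a∩b z∈′ z∈
    base-disjoint 𝐛 𝐛 f≢g _  _  = contradiction ≡.refl f≢g
    base-disjoint 𝐛 𝐜 _   z∈ z∈′ = cyclic-disjoint b≉ε c≉ε c∉⟨b⟩ z∈ z∈′
    base-disjoint 𝐜 𝐚 _   z∈ z∈′ = cyclic-disjoint a≉ε c≉ε c∉⟨a⟩ z∈′ z∈
    base-disjoint 𝐜 𝐛 _   z∈ z∈′ = cyclic-disjoint b≉ε c≉ε c∉⟨b⟩ z∈′ z∈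
    base-disjoint 𝐜 𝐜 f≢g _  _  = contradiction ≡.refl f≢g

    private
      6<p : ∀ {i j} → ∣ i ∣ ≤ 3 → ∣ j ∣ ≤ 3 → ∣ i ∣ ℕ.+ ∣ j ∣ < p
      6<p i≤3 j≤3 = <p 6 (ℕ.+-mono-≤ i≤3 j≤3)

    value≉ε : ∀ {s} → Small s → value s ≉ ε
    value≉ε {f , i} (small i≤3 i≢0 _) eq = i≢0 (^-injective (base≉ε f) i 0ℤ (6<p {i} {0ℤ} i≤3 z≤n) eq)

    value-injective : ∀ {s t} → Small s → Small t → value s ≈ value t → s ≡ t
    value-injective {f , i} {g , j} s-small t-small eq with f ≟ᶠ g
    ... | yes ≡.refl = ≡.cong (f ,_)
      (^-injective (base≉ε f) i j (6<p {i} {j} (Small.bounded s-small) (Small.bounded t-small)) eq)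
    ... | no f≢g = contradiction
      (base-disjoint f g f≢g (power i refl) (power j (sym eq))) (value≉ε s-small)

    rotate : ∀ x y z → x ∙ y ∙ z ≈ ε → y ∙ z ∙ x ≈ ε
    rotate x y z eq = begin
      y ∙ z ∙ x               ≈⟨ solve 3 (λ x y z → y ⊕ z ⊕ x ⊜ ⊝ x ⊕ (x ⊕ y ⊕ z) ⊕ x) refl x y z ⟩
      x ⁻¹ ∙ (x ∙ y ∙ z) ∙ x  ≈⟨ ∙-congʳ (∙-congˡ eq) ⟩
      x ⁻¹ ∙ ε ∙ x            ≈⟨ solve 1 (λ x → ⊝ x ⊕ 𝟙 ⊕ x ⊜ 𝟙) refl x ⟩
      ε                       ∎

    -- The sum of the exponents is at most 9 in absolute value, which is below `p`.
    same-family : ∀ f i j k → ∣ i ∣ ≤ 3 → ∣ j ∣ ≤ 3 → ∣ k ∣ ≤ 3 →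
      base f ^ i ∙ base f ^ j ∙ base f ^ k ≈ ε → i ℤ.+ j ℤ.+ k ≡ 0ℤ
    same-family f i j k i≤3 j≤3 k≤3 eq = ^-order (base≉ε f) (i ℤ.+ j ℤ.+ k)
      (<p 9 (ℕ.≤-trans (ℤ.∣i+j∣≤∣i∣+∣j∣ (i ℤ.+ j) k)
        (ℕ.+-mono-≤ (ℕ.≤-trans (ℤ.∣i+j∣≤∣i∣+∣j∣ i j) (ℕ.+-mono-≤ i≤3 j≤3)) k≤3)))
      (trans (^-homo-+ _ (i ℤ.+ j) k) (trans (∙-congʳ (^-homo-+ _ i j)) eq))

    -- Otherwise `value (g , k)` would be the inverse of a power of `base f`, and so lie in two
    -- cyclic subgroups that meet trivially.
    two-families : ∀ {f g} i j k → f ≢ g → value (g , k) ≉ ε →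
      base f ^ i ∙ base f ^ j ∙ base g ^ k ≉ ε
    two-families {f} {g} i j k f≢g ≉ε eq = ≉ε (base-disjoint f g f≢g
      (power (ℤ.- (i ℤ.+ j)) (begin
        base f ^ (ℤ.- (i ℤ.+ j))        ≈⟨ trans (^-homo-neg _ (i ℤ.+ j)) (⁻¹-cong (^-homo-+ _ i j)) ⟩
        (base f ^ i ∙ base f ^ j) ⁻¹    ≈⟨ inverseʳ-unique _ _ eq ⟨
        base g ^ k                      ∎))
      (power k refl))

    c^1 : base 𝐜 ^ 1ℤ ≈ A ∙ B
    c^1 = identityʳ _

    c^-1 : base 𝐜 ^ -1ℤ ≈ (A ∙ B) ⁻¹
    c^-1 = ⁻¹-cong (identityʳ _)

    private
      ∙-closed : ∀ x {y z} → y ∈ Cyclic x → z ∈ Cyclic x → y ∙ z ∈ Cyclic x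
      ∙-closed x = IsSubgroup.∙-closed (cyclic-isSubgroup x)

      ⁻¹-closed : ∀ x {y} → y ∈ Cyclic x → y ⁻¹ ∈ Cyclic x
      ⁻¹-closed x = IsSubgroup.⁻¹-closed (cyclic-isSubgroup x)

    -- The element x′⁻¹x = y′y⁻¹ lies in both cyclic subgroups.
    ab-unique : ∀ {x x′ y y′} → x ∈ Cyclic a → x′ ∈ Cyclic a → y ∈ Cyclic b → y′ ∈ Cyclic b →
      x ∙ y ≈ x′ ∙ y′ → x ≈ x′ × y ≈ y′
    ab-unique {x} {x′} {y} {y′} x∈ x′∈ y∈ y′∈ eq = x≈x′ , ∙-cancelˡ x y y′ (trans eq (∙-congʳ (sym x≈x′)))
      where
      x≈x′ : x ≈ x′
      x≈x′ = begin
        x                  ≈⟨ \\-leftDividesˡ x′ x ⟨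
        x′ ∙ (x′ ⁻¹ ∙ x)   ≈⟨ ∙-congˡ (a∩b (∙-closed a (⁻¹-closed a x′∈) x∈)
                                (cyclic-respects y′y⁻¹≈ (∙-closed b y′∈ (⁻¹-closed b y∈)))) ⟩
        x′ ∙ ε             ≈⟨ identityʳ x′ ⟩
        x′                 ∎
        where
        y′y⁻¹≈ : y′ ∙ y ⁻¹ ≈ x′ ⁻¹ ∙ x
        y′y⁻¹≈ = begin
          y′ ∙ y ⁻¹                   ≈⟨ solve 3 (λ x y z → y ⊕ ⊝ z ⊜ ⊝ x ⊕ (x ⊕ y) ⊕ ⊝ z) refl x′ y′ y ⟩
          x′ ⁻¹ ∙ (x′ ∙ y′) ∙ y ⁻¹    ≈⟨ ∙-congʳ (∙-congˡ eq) ⟨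
          x′ ⁻¹ ∙ (x ∙ y) ∙ y ⁻¹      ≈⟨ solve 3 (λ x y z → ⊝ x ⊕ (y ⊕ z) ⊕ ⊝ z ⊜ ⊝ x ⊕ y) refl x′ x y ⟩
          x′ ⁻¹ ∙ x                   ∎

    -- For `k` = 1 the relation rotates to a³b²aⁱ = b⁻ʲ, which `generic` forbids. For `k` = -1 it
    -- reads aⁱbʲ = a³b², and `ab-unique` compares the factors.
    abc-relator : ∀ i j k → Small (𝐚 , i) → Small (𝐛 , j) → Small (𝐜 , k) →
      a ^ i ∙ b ^ j ∙ base 𝐜 ^ k ≈ ε → i ≡ + 3 × j ≡ + 2 × k ≡ -1ℤ
    abc-relator i j k (small i≤3 _ _) (small j≤3 _ _) (small _ _ c-unit) eq with c-unit ≡.refl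
    ... | inj₁ ≡.refl = contradiction
      (power (ℤ.- j) (begin
        b ^ (ℤ.- j)      ≈⟨ ^-homo-neg b j ⟩
        (b ^ j) ⁻¹       ≈⟨ inverseʳ-unique _ _ (begin
          b ^ j ∙ (A ∙ B ∙ a ^ i)  ≈⟨ assoc _ _ _ ⟨
          b ^ j ∙ (A ∙ B) ∙ a ^ i  ≈⟨ rotate _ _ _ (trans (∙-congˡ (sym c^1)) eq) ⟩
          ε                        ∎) ⟨
        A ∙ B ∙ a ^ i    ∎))
      (generic i i≤3)
    ... | inj₂ ≡.refl =
      let x≈A , y≈B = ab-unique (power i refl) (power (+ 3) refl) (power j refl) (power (+ 2) refl)
            (x∙y⁻¹≈ε⇒x≈y _ _ (trans (∙-congˡ (sym c^-1)) eq))
      in ^-injective a≉ε i (+ 3) (6<p {i} {+ 3} i≤3 ℕ.≤-refl) x≈A ,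
         ^-injective b≉ε j (+ 2) (6<p {j} {+ 2} j≤3 (ℕ.n≤1+n 2)) y≈B , ≡.refl

    -- For `k` = 1 the product regroups as (aⁱa³)(b²bʲ) = 1, so that both factors are trivial. For
    -- `k` = -1 the relation gives a³b²a⁻ⁱ = bʲ, which `generic` forbids.
    acb-relator : ∀ i j k → Small (𝐚 , i) → Small (𝐛 , j) → Small (𝐜 , k) →
      a ^ i ∙ base 𝐜 ^ k ∙ b ^ j ≈ ε → i ≡ -[1+ 2 ] × j ≡ -[1+ 1 ] × k ≡ 1ℤ
    acb-relator i j k (small i≤3 _ _) (small j≤3 _ _) (small _ _ c-unit) eq with c-unit ≡.refl
    ... | inj₁ ≡.refl =
      let xA≈ε , By≈ε = ab-unique (∙-closed a (power i refl) (power (+ 3) refl)) (power 0ℤ refl)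
            (∙-closed b (power (+ 2) refl) (power j refl)) (power 0ℤ refl) (begin
              a ^ i ∙ A ∙ (B ∙ b ^ j)       ≈⟨ solve 4 (λ x A B y → x ⊕ A ⊕ (B ⊕ y) ⊜ x ⊕ (A ⊕ B) ⊕ y) refl _ A B _ ⟩
              a ^ i ∙ (A ∙ B) ∙ b ^ j       ≈⟨ ∙-congʳ (∙-congˡ c^1) ⟨
              a ^ i ∙ base 𝐜 ^ 1ℤ ∙ b ^ j   ≈⟨ eq ⟩
              ε                             ≈⟨ identityˡ ε ⟨
              ε ∙ ε                         ∎)
      in ^-injective a≉ε i -[1+ 2 ] (6<p {i} { -[1+ 2 ]} i≤3 ℕ.≤-refl) (inverseˡ-unique _ _ xA≈ε) ,
         ^-injective b≉ε j -[1+ 1 ] (6<p {j} { -[1+ 1 ]} j≤3 (ℕ.n≤1+n 2)) (inverseʳ-unique _ _ By≈ε) , ≡.refl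
    ... | inj₂ ≡.refl = contradiction
      (power j (begin
        b ^ j                                               ≈⟨ solve 3 (λ x y d → y ⊜ d ⊕ ⊝ x ⊕ (x ⊕ ⊝ d ⊕ y)) refl (a ^ i) (b ^ j) (A ∙ B) ⟩
        A ∙ B ∙ (a ^ i) ⁻¹ ∙ (a ^ i ∙ (A ∙ B) ⁻¹ ∙ b ^ j)   ≈⟨ ∙-congˡ (trans (∙-congʳ (∙-congˡ (sym c^-1))) eq) ⟩
        A ∙ B ∙ (a ^ i) ⁻¹ ∙ ε                              ≈⟨ identityʳ _ ⟩
        A ∙ B ∙ (a ^ i) ⁻¹                                  ≈⟨ ∙-congˡ (^-homo-neg a i) ⟨
        A ∙ B ∙ a ^ (ℤ.- i)                                 ∎))
      (generic (ℤ.- i) (≡.subst (_≤ 3) (≡.sym (ℤ.∣-i∣≡∣i∣ i)) i≤3))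

    rotate² : ∀ x y z → x ∙ y ∙ z ≈ ε → z ∙ x ∙ y ≈ ε
    rotate² x y z eq = rotate y z x (rotate x y z eq)

    -- Relations may be rotated. This brings three different families into the order a, b, c or a,
    -- c, b, and moves two equal families to the front.
    relator-complete : ∀ {s t u} → Small s → Small t → Small u →
      value s ∙ value t ∙ value u ≈ ε → Relator s t u
    relator-complete {f , i} {g , j} {h , k} s-small t-small u-small eq with view f g h
    ... | fff     = inj₁ (≡.refl , ≡.refl ,
      same-family f i j k (Small.bounded s-small) (Small.bounded t-small) (Small.bounded u-small) eq)
    ... | ffg f≢g = contradiction eq (two-families i j k f≢g (value≉ε u-small))
    ... | fgf f≢g = contradiction (rotate² _ _ _ eq) (two-families k i j f≢g (value≉ε t-small))
    ... | gff f≢g = contradiction (rotate _ _ _ eq) (two-families j k i f≢g (value≉ε s-small))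
    ... | abc with ≡.refl , ≡.refl , ≡.refl ← abc-relator i j k s-small t-small u-small eq =
      inj₂ (here ≡.refl)
    ... | bca with ≡.refl , ≡.refl , ≡.refl ← abc-relator k i j u-small s-small t-small (rotate² _ _ _ eq) =
      inj₂ (there (here ≡.refl))
    ... | cab with ≡.refl , ≡.refl , ≡.refl ← abc-relator j k i t-small u-small s-small (rotate _ _ _ eq) =
      inj₂ (there (there (here ≡.refl)))
    ... | acb with ≡.refl , ≡.refl , ≡.refl ← acb-relator i k j s-small u-small t-small eq =
      inj₂ (there (there (there (here ≡.refl))))
    ... | cba with ≡.refl , ≡.refl , ≡.refl ← acb-relator k j i u-small t-small s-small (rotate² _ _ _ eq) =
      inj₂ (there (there (there (there (here ≡.refl)))))
    ... | bac with ≡.refl , ≡.refl , ≡.refl ← acb-relator j i k t-small s-small u-small (rotate _ _ _ eq) =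
      inj₂ (there (there (there (there (there (here ≡.refl))))))

    abc≈ε : A ∙ B ∙ base 𝐜 ^ -1ℤ ≈ ε
    abc≈ε = trans (∙-congˡ c^-1) (inverseʳ _)

    acb≈ε : A ⁻¹ ∙ base 𝐜 ^ 1ℤ ∙ B ⁻¹ ≈ ε
    acb≈ε = trans (∙-congʳ (∙-congˡ c^1)) (solve 2 (λ A B → ⊝ A ⊕ (A ⊕ B) ⊕ ⊝ B ⊜ 𝟙) refl A B)

    relator-sound : ∀ {s t u} → Relator s t u → value s ∙ value t ∙ value u ≈ ε
    relator-sound {f , i} {_ , j} {_ , k} (inj₁ (≡.refl , ≡.refl , i+j+k≡0)) = begin
      base f ^ i ∙ base f ^ j ∙ base f ^ k  ≈⟨ trans (^-homo-+ _ (i ℤ.+ j) k) (∙-congʳ (^-homo-+ _ i j)) ⟨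
      base f ^ (i ℤ.+ j ℤ.+ k)              ≡⟨ ≡.cong (base f ^_) i+j+k≡0 ⟩
      ε                                     ∎
    relator-sound (inj₂ (here ≡.refl)) = abc≈ε
    relator-sound (inj₂ (there (here ≡.refl))) = rotate _ _ _ abc≈ε
    relator-sound (inj₂ (there (there (here ≡.refl)))) = rotate² _ _ _ abc≈ε
    relator-sound (inj₂ (there (there (there (here ≡.refl))))) = acb≈ε
    relator-sound (inj₂ (there (there (there (there (here ≡.refl)))))) = rotate _ _ _ acb≈ε
    relator-sound (inj₂ (there (there (there (there (there (here ≡.refl))))))) = rotate² _ _ _ acb≈ε

    value-⁻ : ∀ s → value (s ⁻) ≈ value s ⁻¹
    value-⁻ (f , i) = ^-homo-neg (base f) i

    generator : Fin 12 → Carrier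
    generator i = value (letter i)

    generator-injective : Injective _≡_ _≈_ generator
    generator-injective {i} {j} eq =
      letter-injective i j (value-injective (letter-small i) (letter-small j) eq)

    adjacent-sound : ∀ i j → Adjacent i j → ∃ λ k → generator k ≈ generator i ⁻¹ ∙ generator j
    adjacent-sound i j (k , relator) = k , (begin
      generator k            ≈⟨ ⁻¹-involutive _ ⟨
      generator k ⁻¹ ⁻¹      ≈⟨ inverseˡ-unique _ _ (begin
        generator i ⁻¹ ∙ generator j ∙ generator k ⁻¹
          ≈⟨ ∙-cong (∙-congʳ (value-⁻ (letter i))) (value-⁻ (letter k)) ⟨
        value (letter i ⁻) ∙ generator j ∙ value (letter k ⁻)  ≈⟨ relator-sound relator ⟩
        ε                                                     ∎) ⟨
      generator i ⁻¹ ∙ generator j  ∎)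

    adjacent-complete : ∀ i j {k} → generator k ≈ generator i ⁻¹ ∙ generator j → Adjacent i j
    adjacent-complete i j {k} eq = k , relator-complete
      (small-⁻ (letter-small i)) (letter-small j) (small-⁻ (letter-small k)) (begin
        value (letter i ⁻) ∙ generator j ∙ value (letter k ⁻)
          ≈⟨ ∙-cong (∙-congʳ (value-⁻ (letter i))) (value-⁻ (letter k)) ⟩
        generator i ⁻¹ ∙ generator j ∙ generator k ⁻¹  ≈⟨ x≈y⇒x∙y⁻¹≈ε (sym eq) ⟩
        ε                                              ∎)

    -- Closure under inverses means that every neighbour in the Cayley graph is reached by right
    -- multiplication with a generator.
    generator-inverse : ∀ i → ∃ λ j → generator j ≈ generator i ⁻¹
    generator-inverse i = let j , eq = letter-inverse i in
      j , trans (reflexive (≡.cong value eq)) (value-⁻ (letter i))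

    Member : Pred Carrier ℓ
    Member x = ∃ λ i → generator i ≈ x

    T : GeneratingSet G
    T = record
      { member    = Member
      ; respects  = λ x≈y (i , eq) → i , trans eq x≈y
      ; ε∉        = λ (i , eq) → value≉ε (letter-small i) eq
      -- The letters at positions 0 and 6 are `a` and `b`; as `Cyclic a` is maximal and misses `b`,
      -- they already generate `G`.
      ; generates = universal a≉ε
          (record { respects = resp ; ε-closed = unit ; ∙-closed = mul ; ⁻¹-closed = inv })
          (gen (0F , identityʳ a)) (gen (6F , identityʳ b)) b∉⟨a⟩
      }

    T-size : HasSize 12 (members G T)
    T-size = FiniteSetoid.covers∧injective⇒hasSize (members G T)
      {f = λ i → generator i , i , refl} (λ (_ , i , eq) → i , eq) generator-injective

-- Coverings of the Cayley graph

module Coverings (em : ∀ {a} → ExcludedMiddle a)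
  {c ℓ} (G : Group c ℓ) (p : ℕ) (monster : IsTarskiMonster G p) (p>263 : p > 263)
  (pair : Generators.GenericPair em G p monster p>263) where

  open Group G renaming (setoid to elements)
  open GroupProperties G
  open GroupSolver G using (solve; _⊜_; _⊕_; ⊝_)
  open Powers G
  open TarskiMonster em G p monster
  open Generators em G p monster p>263
  open Link pair

  Γ : Graph c ℓ ℓ
  Γ = Cay G T

  module Γ = Graph Γ

  step : Carrier → Fin 12 → Carrier
  step g i = g ∙ generator i

  step-neighbour : ∀ g i → g Γ.~ step g i
  step-neighbour g i = inj₁ (i , sym (\\-leftDividesʳ g (generator i)))

  neighbour⇒step : ∀ {g h} → g Γ.~ h → ∃ λ i → step g i ≈ h
  neighbour⇒step {g} {h} (inj₁ (i , eq)) = i , trans (∙-congˡ eq) (\\-leftDividesˡ g h)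
  neighbour⇒step {g} {h} (inj₂ (i , eq)) =
    let j , inverse = generator-inverse i
    in j , trans (∙-congˡ (trans inverse (trans (⁻¹-cong eq) (⁻¹-involutive _)))) (\\-leftDividesˡ g h)

  step-difference : ∀ g i j → step g i ⁻¹ ∙ step g j ≈ generator i ⁻¹ ∙ generator j
  step-difference g i j = solve 3 (λ g x y → ⊝ (g ⊕ x) ⊕ (g ⊕ y) ⊜ ⊝ x ⊕ y) refl g _ _

  -- Left translation by `g` cancels, so the graph on the neighbours is the same at every vertex.
  step-adjacent : ∀ g i j → (step g i Γ.~ step g j) ⇔ Adjacent i j
  step-adjacent g i j = mk⇔
    (λ adj → let k , eq = neighbour⇒step adj in adjacent-complete i j {k} (begin
      generator k                            ≈⟨ \\-leftDividesʳ (step g i) _ ⟨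
      step g i ⁻¹ ∙ (step g i ∙ generator k) ≈⟨ ∙-congˡ eq ⟩
      step g i ⁻¹ ∙ step g j                 ≈⟨ step-difference g i j ⟩
      generator i ⁻¹ ∙ generator j           ∎))
    (λ adj → let k , eq = adjacent-sound i j adj in
      inj₁ (k , trans eq (sym (step-difference g i j))))
    where open SetoidReasoning elements

  module _ {v ℓ′ e} (Δ : Graph v ℓ′ e) (ψ : Carrier → Graph.Vertex Δ)
    (covering : IsCovering Γ Δ ψ) (onBalls : IsIsomorphismOnBalls₁ Γ Δ ψ) where

    module Δ = Graph Δ
    module Δ≈ = Setoid Δ.vertices
    open IsCovering covering using (neighbours) renaming (cong to ψ-cong; surjective to ψ-surjective)
    open SetoidReasoning Δ.vertices

    ~-resp : ∀ {x x′ y y′} → x Δ.≈ x′ → y Δ.≈ y′ → x Δ.~ y → x′ Δ.~ y′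
    ~-resp x≈x′ y≈y′ = proj₂ Δ.~-resp-≈ x≈x′ ∘ proj₁ Δ.~-resp-≈ y≈y′

    ψ-mono : ∀ {g h} → g Γ.~ h → ψ g Δ.~ ψ h
    ψ-mono {g} = proj₁ (neighbours g)

    ψ-step-injective : ∀ g {i j} → ψ (step g i) Δ.≈ ψ (step g j) → i ≡ j
    ψ-step-injective g {i} {j} eq = generator-injective (∙-cancelˡ g _ _
      (proj₁ (proj₂ (neighbours g)) {step g i , step-neighbour g i} {step g j , step-neighbour g j} eq))

    lift-neighbour : ∀ g {x} → ψ g Δ.~ x → ∃ λ i → ψ (step g i) Δ.≈ x
    lift-neighbour g ψg~x =
      let (h , g~h) , ψh≈x = proj₂ (proj₂ (neighbours g)) (_ , ψg~x)
          i , eq = neighbour⇒step g~h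
      in i , Δ≈.trans (ψ-cong eq) (ψh≈x {h , g~h} refl)

    -- Here the hypothesis on balls enters: a covering preserves edges between neighbours of `g`,
    -- but reflecting them takes the isomorphism of balls.
    ψ-step-adjacent : ∀ g i j → (ψ (step g i) Δ.~ ψ (step g j)) ⇔ Adjacent i j
    ψ-step-adjacent g i j = mk⇔
      (Equivalence.to (step-adjacent g i j) ∘ cancel {inBall i} {inBall j})
      (ψ-mono ∘ Equivalence.from (step-adjacent g i j))
      where
      open IsOrderIsomorphism (proj₂ (onBalls g)) using (cancel)

      inBall : Fin 12 → ∃ (Γ.Ball₁ g)
      inBall i = step g i , inj₂ (step-neighbour g i)

    module _ (α : Δ.Vertex → Δ.Vertex) (α-iso : IsGraphIsomorphism Δ Δ α) where
      private module α = IsOrderIsomorphism α-iso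

      module _ {g h} (αψg≈ψh : α (ψ g) Δ.≈ ψ h) where
        forth : ∀ i → ∃ λ j → ψ (step h j) Δ.≈ α (ψ (step g i))
        forth i = lift-neighbour h (~-resp αψg≈ψh Δ≈.refl (α.mono (ψ-mono (step-neighbour g i))))

        back : ∀ j → ∃ λ i → α (ψ (step g i)) Δ.≈ ψ (step h j)
        back j =
          let x , αx≈ = α.surjective (ψ (step h j))
              i , eq  = lift-neighbour g (α.cancel
                (~-resp (Δ≈.sym αψg≈ψh) (Δ≈.sym (αx≈ Δ≈.refl)) (ψ-mono (step-neighbour h j))))
          in i , Δ≈.trans (α.cong eq) (αx≈ Δ≈.refl)

        -- The bijection that `α` induces from the neighbours of `ψ g` to those of `ψ h`, read off
        -- on the labels of the generators.
        π : Permutation′ 12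
        π = mk↔ₛ′ (proj₁ ∘ forth) (proj₁ ∘ back)
          (λ j → ψ-step-injective h (Δ≈.trans (proj₂ (forth _)) (proj₂ (back j))))
          (λ i → ψ-step-injective g (α.injective (Δ≈.trans (proj₂ (back _)) (proj₂ (forth i)))))

        π-iso : ∀ i j → Adjacent (π ⟨$⟩ʳ i) (π ⟨$⟩ʳ j) ⇔ Adjacent i j
        π-iso i j = mk⇔
          (Equivalence.to (ψ-step-adjacent g i j) ∘ α.cancel ∘
            ~-resp (proj₂ (forth i)) (proj₂ (forth j)) ∘
            Equivalence.from (ψ-step-adjacent h (π ⟨$⟩ʳ i) (π ⟨$⟩ʳ j)))
          (Equivalence.to (ψ-step-adjacent h (π ⟨$⟩ʳ i) (π ⟨$⟩ʳ j)) ∘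
            ~-resp (Δ≈.sym (proj₂ (forth i))) (Δ≈.sym (proj₂ (forth j))) ∘ α.mono ∘
            Equivalence.from (ψ-step-adjacent g i j))

        -- By `rigid` the permutation `π` is the identity, so `α` preserves labels.
        step-equivariant : ∀ i → α (ψ (step g i)) Δ.≈ ψ (step h i)
        step-equivariant i = Δ≈.trans (Δ≈.sym (proj₂ (forth i)))
          (Δ≈.reflexive (≡.cong (ψ ∘ step h) (rigid π π-iso i)))

      -- Quantifying over all pairs `g`, `h` gives closure under products: after a translation by
      -- `k`, the pair `g ∙ k`, `h ∙ k` is again admissible.
      Equivariant : Pred Carrier _
      Equivariant k = ∀ {g h} → α (ψ g) Δ.≈ ψ h → α (ψ (g ∙ k)) Δ.≈ ψ (h ∙ k)

      equivariant-resp : ∀ {k l} → k ≈ l → Equivariant k → Equivariant l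
      equivariant-resp k≈l k-eq αψg≈ψh = Δ≈.trans (α.cong (ψ-cong (∙-congˡ (sym k≈l))))
        (Δ≈.trans (k-eq αψg≈ψh) (ψ-cong (∙-congˡ k≈l)))

      equivariant-∙ : ∀ {k l} → Equivariant k → Equivariant l → Equivariant (k ∙ l)
      equivariant-∙ {k} {l} k-eq l-eq {g} {h} αψg≈ψh =
        Δ≈.trans (α.cong (ψ-cong (sym (assoc g k l))))
          (Δ≈.trans (l-eq (k-eq αψg≈ψh)) (ψ-cong (assoc h k l)))

      equivariant-ε : Equivariant ε
      equivariant-ε αψg≈ψh = Δ≈.trans (α.cong (ψ-cong (identityʳ _)))
        (Δ≈.trans αψg≈ψh (ψ-cong (sym (identityʳ _))))

      -- Inverses are carried along because Equivariant is not visibly closed under them.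
      span-equivariant : ∀ {k} → k ∈ ⟨ G ⟩ Member → Equivariant k × Equivariant (k ⁻¹)
      span-equivariant (gen (i , eq)) =
        let j , inverse = generator-inverse i in
        equivariant-resp eq (λ αψg≈ψh → step-equivariant αψg≈ψh i) ,
        equivariant-resp (trans inverse (⁻¹-cong eq)) (λ αψg≈ψh → step-equivariant αψg≈ψh j)
      span-equivariant unit = equivariant-ε , equivariant-resp (sym ε⁻¹≈ε) equivariant-ε
      span-equivariant (mul x∈ y∈) =
        let x-eq , x⁻¹-eq = span-equivariant x∈ ; y-eq , y⁻¹-eq = span-equivariant y∈ in
        equivariant-∙ x-eq y-eq ,
        equivariant-resp (sym (⁻¹-anti-homo-∙ _ _)) (equivariant-∙ y⁻¹-eq x⁻¹-eq)
      span-equivariant (inv x∈) =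
        let x-eq , x⁻¹-eq = span-equivariant x∈ in
        x⁻¹-eq , equivariant-resp (sym (⁻¹-involutive _)) x-eq
      span-equivariant (resp x≈y x∈) =
        let x-eq , x⁻¹-eq = span-equivariant x∈ in
        equivariant-resp x≈y x-eq , equivariant-resp (⁻¹-cong x≈y) x⁻¹-eq

      equivariant : ∀ k → Equivariant k
      equivariant k = proj₁ (span-equivariant (GeneratingSet.generates T k))

    -- The identity automorphism already gives information: right translations respect the fibres of
    -- `ψ`.
    translate : ∀ k {g h} → ψ g Δ.≈ ψ h → ψ (g ∙ k) Δ.≈ ψ (h ∙ k)
    translate k = equivariant (proj₁ (idAut Δ)) (proj₂ (idAut Δ)) k

    -- Excluded middle brings ψ x ≈ ψ ε down to the level required by IsTarskiMonster.
    Fibre : Pred Carrier (c ⊔ ℓ)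
    Fibre x = Lift _ (True (em {P = ψ x Δ.≈ ψ ε}))

    fibre⁺ : ∀ {x} → ψ x Δ.≈ ψ ε → x ∈ Fibre
    fibre⁺ = lift ∘ fromWitness

    fibre⁻ : ∀ {x} → x ∈ Fibre → ψ x Δ.≈ ψ ε
    fibre⁻ = toWitness ∘ lower

    fibre-isSubgroup : IsSubgroup G Fibre
    fibre-isSubgroup = record
      { respects  = λ x≈y x∈ → fibre⁺ (Δ≈.trans (ψ-cong (sym x≈y)) (fibre⁻ x∈))
      ; ε-closed  = fibre⁺ Δ≈.refl
      ; ∙-closed  = λ {x} {y} x∈ y∈ → fibre⁺ (begin
          ψ (x ∙ y)  ≈⟨ translate y (fibre⁻ x∈) ⟩
          ψ (ε ∙ y)  ≈⟨ ψ-cong (identityˡ y) ⟩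
          ψ y        ≈⟨ fibre⁻ y∈ ⟩
          ψ ε        ∎)
      ; ⁻¹-closed = λ {x} x∈ → fibre⁺ (begin
          ψ (x ⁻¹)      ≈⟨ ψ-cong (identityˡ (x ⁻¹)) ⟨
          ψ (ε ∙ x ⁻¹)  ≈⟨ translate (x ⁻¹) (fibre⁻ x∈) ⟨
          ψ (x ∙ x ⁻¹)  ≈⟨ ψ-cong (inverseʳ x) ⟩
          ψ ε           ∎)
      }

    -- Translation by `h ⁻¹` carries `ψ h` to `ψ ε`. Together with `fibre⇒ψ≈`, this makes the fibres
    -- of `ψ` the right cosets of `Fibre`.
    ψ≈⇒fibre : ∀ {g h} → ψ g Δ.≈ ψ h → g ∙ h ⁻¹ ∈ Fibre
    ψ≈⇒fibre {g} {h} eq = fibre⁺ (Δ≈.trans (translate (h ⁻¹) eq) (ψ-cong (inverseʳ h)))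

    fibre⇒ψ≈ : ∀ {g h} → g ∙ h ⁻¹ ∈ Fibre → ψ g Δ.≈ ψ h
    fibre⇒ψ≈ {g} {h} gh⁻¹∈ = begin
      ψ g               ≈⟨ ψ-cong (//-rightDividesˡ h g) ⟨
      ψ (g ∙ h ⁻¹ ∙ h)  ≈⟨ translate h (fibre⁻ gh⁻¹∈) ⟩
      ψ (ε ∙ h)         ≈⟨ ψ-cong (identityˡ h) ⟩
      ψ h               ∎

    -- The two vertices are adjacent, and `Δ` has no loops.
    ψ-nonconstant : ¬ (ψ ε Δ.≈ ψ (step ε 0F))
    ψ-nonconstant eq = Δ.~-irrefl eq (ψ-mono (step-neighbour ε 0F))

    fibre-proper : Proper G Fibre
    fibre-proper = step ε 0F , λ ∈Fibre → ψ-nonconstant (Δ≈.sym (fibre⁻ ∈Fibre))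

    trivialFibre⇒isomorphism : (∀ {x} → x ∈ Fibre → x ≈ ε) → IsGraphIsomorphism Γ Δ ψ
    trivialFibre⇒isomorphism trivial = record
      { isOrderMonomorphism = record
        { isOrderHomomorphism = record { cong = ψ-cong ; mono = ψ-mono }
        ; injective = ψ-injective
        -- The edge lifts to an edge from `g` whose other end has image `ψ h`; by injectivity that
        -- end is `h`.
        ; cancel = λ {g} ψg~ψh →
            let i , eq = lift-neighbour g ψg~ψh
            in proj₁ Γ.~-resp-≈ (ψ-injective eq) (step-neighbour g i)
        }
      ; surjective = ψ-surjective
      }
      where
      ψ-injective : ∀ {g h} → ψ g Δ.≈ ψ h → g ≈ h
      ψ-injective eq = x∙y⁻¹≈ε⇒x≈y _ _ (trivial (ψ≈⇒fibre eq))

    module _ {x} (x∈ : x ∈ Fibre) (x≉ε : x ≉ ε) where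

      fibre⊆cyclic : Fibre ⊆ Cyclic x
      fibre⊆cyclic = proper⇒⊆cyclic x≉ε fibre-isSubgroup x∈ fibre-proper

      -- Every element of `G` is an element of `Cyclic x` times a chosen preimage of a vertex, so
      -- `n` vertices would leave at most `p ℕ.* n` elements.
      Δ-infinite : Infinite Δ.vertices
      Δ-infinite (n , size) = ¬covered f f-covers
        where
        vertex : Fin n → Δ.Vertex
        vertex = Bijection.to size

        section : Fin n → Carrier
        section i = proj₁ (ψ-surjective (vertex i))

        power-of-x : Fin p → Carrier
        power-of-x j = proj₁ (FiniteSetoid.enumerate _ (cyclic-size x≉ε) j)

        f : Fin (p ℕ.* n) → Carrier
        f k = let j , i = remQuot {p} n k in power-of-x j ∙ section i

        f-covers : FiniteSetoid.Covers elements f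
        f-covers g =
          let i , i-eq = FiniteSetoid.enumerate-covers Δ.vertices size (ψ g)
              ψg≈ = Δ≈.trans (Δ≈.sym i-eq) (Δ≈.sym (proj₂ (ψ-surjective (vertex i)) refl))
              j , j-eq = FiniteSetoid.enumerate-covers _ (cyclic-size x≉ε)
                (g ∙ section i ⁻¹ , fibre⊆cyclic (ψ≈⇒fibre ψg≈))
          in combine j i , trans
            (reflexive (≡.cong (λ (j , i) → power-of-x j ∙ section i) (Fin.remQuot-combine j i)))
            (trans (∙-congʳ j-eq) (//-rightDividesˡ (section i) g))

      -- If α ψ(g) = ψ(h), then right translation by g⁻¹xg fixes ψ(g), hence ψ(h), so h g⁻¹
      -- normalises ⟨x⟩.
      automorphisms-trivial : ∀ {y z} → SameOrbit Δ y z → y Δ.≈ z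
      automorphisms-trivial {y} {z} ((α , α-iso) , αy≈z) =
        Δ≈.trans (Δ≈.sym (ψ∘section y)) (Δ≈.trans (fibre⇒ψ≈ gh⁻¹∈) (ψ∘section z))
        where
        open IsOrderIsomorphism α-iso using () renaming (cong to α-cong)
        g = proj₁ (ψ-surjective y)
        h = proj₁ (ψ-surjective z)

        ψ∘section : ∀ y → ψ (proj₁ (ψ-surjective y)) Δ.≈ y
        ψ∘section y = proj₂ (ψ-surjective y) refl

        αψg≈ψh : α (ψ g) Δ.≈ ψ h
        αψg≈ψh = Δ≈.trans (α-cong (ψ∘section y)) (Δ≈.trans αy≈z (Δ≈.sym (ψ∘section z)))

        k = g ⁻¹ ∙ x ∙ g

        ψgk≈ψg : ψ (g ∙ k) Δ.≈ ψ g
        ψgk≈ψg = fibre⇒ψ≈ (IsSubgroup.respects fibre-isSubgroup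
          (solve 2 (λ g x → x ⊜ g ⊕ (⊝ g ⊕ x ⊕ g) ⊕ ⊝ g) refl g x) x∈)

        ψhk≈ψh : ψ (h ∙ k) Δ.≈ ψ h
        ψhk≈ψh = begin
          ψ (h ∙ k)      ≈⟨ equivariant α α-iso k αψg≈ψh ⟨
          α (ψ (g ∙ k))  ≈⟨ α-cong ψgk≈ψg ⟩
          α (ψ g)        ≈⟨ αψg≈ψh ⟩
          ψ h            ∎

        -- h k h⁻¹ is the conjugate of `x` by `h ∙ g ⁻¹`, and it lies in `Fibre`, hence in
        -- `Cyclic x`.
        hg⁻¹∈ : h ∙ g ⁻¹ ∈ Cyclic x
        hg⁻¹∈ = self-normalising x≉ε (cyclic-respects
          (solve 3 (λ g h x → h ⊕ (⊝ g ⊕ x ⊕ g) ⊕ ⊝ h ⊜ h ⊕ ⊝ g ⊕ x ⊕ ⊝ (h ⊕ ⊝ g)) refl g h x)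
          (fibre⊆cyclic (ψ≈⇒fibre ψhk≈ψh)))

        gh⁻¹∈ : g ∙ h ⁻¹ ∈ Fibre
        gh⁻¹∈ = IsSubgroup.respects fibre-isSubgroup
          (solve 2 (λ g h → ⊝ (h ⊕ ⊝ g) ⊜ g ⊕ ⊝ h) refl g h)
          (IsSubgroup.⁻¹-closed fibre-isSubgroup (cyclic⊆ fibre-isSubgroup x∈ hg⁻¹∈))

      finite-orbits : HasFiniteOrbits Δ
      -- Every orbit is a single vertex.
      finite-orbits y = 1 , FiniteSetoid.covers∧injective⇒hasSize _
        {f = λ _ → y , idAut Δ , Δ≈.refl}
        (λ (z , y∼z) → zero , automorphisms-trivial y∼z)
        (λ { {zero} {zero} _ → ≡.refl ; {suc ()} ; {zero} {suc ()} })

      ¬vertexTransitive : ¬ IsVertexTransitive Δ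
      ¬vertexTransitive transitive = ψ-nonconstant (automorphisms-trivial (transitive _ _))

      -- As orbits are single vertices, an enumeration of the orbits would enumerate the infinitely
      -- many vertices.
      ¬quasiTransitive : ¬ IsQuasiTransitive Δ
      ¬quasiTransitive (n , size) = Δ-infinite (n , record
        { to        = Bijection.to size
        ; cong      = λ { ≡.refl → Δ≈.refl }
        ; bijective = (λ eq → Bijection.injective size (idAut Δ , eq)) ,
            λ y → proj₁ (Bijection.surjective size y) ,
              λ eq → automorphisms-trivial (proj₂ (Bijection.surjective size y) eq)
        })

    dichotomy : IsGraphIsomorphism Γ Δ ψ ⊎
      (Infinite Δ.vertices × HasFiniteOrbits Δ × ¬ IsVertexTransitive Δ × ¬ IsQuasiTransitive Δ)
    dichotomy with em {P = NonTrivial G Fibre}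
    ... | yes (x , x∈ , x≉ε) = inj₂ (Δ-infinite x∈ x≉ε , finite-orbits x∈ x≉ε ,
      ¬vertexTransitive x∈ x≉ε , ¬quasiTransitive x∈ x≉ε)
    ... | no trivial = inj₁ (trivialFibre⇒isomorphism λ x∈ →
      by-contradiction λ x≉ε → trivial (_ , x∈ , x≉ε))

theorem15 : (∀ {a} → ExcludedMiddle a) →
    ∀ {c ℓ v ℓ′ e} (p : ℕ) → Prime p → p > 263 →
    (G : Group c ℓ) → IsTarskiMonster G p →
    Σ (GeneratingSet G) λ T →
    HasSize 12 (members G T) ×
    ((Δ : Graph v ℓ′ e) (ψ : Group.Carrier G → Graph.Vertex Δ) →
    IsCovering (Cay G T) Δ ψ → IsIsomorphismOnBalls₁ (Cay G T) Δ ψ →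
    (IsGraphIsomorphism (Cay G T) Δ ψ ⊎
    (Infinite (Graph.vertices Δ) × HasFiniteOrbits Δ)) ×
    (¬ IsGraphIsomorphism (Cay G T) Δ ψ →
    ¬ IsVertexTransitive Δ × ¬ IsQuasiTransitive Δ))
theorem15 em p _ p>263 G monster = T , T-size , λ Δ ψ covering onBalls →
  conclude (dichotomy Δ ψ covering onBalls)
  where
  open Generators em G p monster p>263
  open Link genericPair
  open Coverings em G p monster p>263 genericPair

  conclude : ∀ {i j k l m} {I : Set i} {J : Set j} {K : Set k} {L : Set l} {M : Set m} →
    I ⊎ (J × K × L × M) → (I ⊎ (J × K)) × (¬ I → L × M)
  conclude (inj₁ i)               = inj₁ i , contradiction i
  conclude (inj₂ (j , k , l , m)) = inj₂ (j , k) , λ _ → l , m
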